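{- Let $\mathcal{M}=(E,\rho)$ be a $q$-matroid with $\dim E\ge 2$. The following are equivalent: (i) $\mathcal{M}$ is irreducible; (ii) $\mathcal{M}$ is full and there do not exist nonzero subspaces $Z_1,Z_2\in\mathcal{Z}(\mathcal{M})$ such that $E=Z_1\oplus Z_2$ (i.e. $Z_1+Z_2=E$ and $Z_1\cap Z_2=0$), $\rho(Z_1)+\rho(Z_2)=\rho(E)$, and $\{Y_1\oplus Y_2\mid Y_1\in\mathcal{Z}_1,\ Y_2\in\mathcal{Z}_2\}=\mathcal{Z}(\mathcal{M})$, where $\mathcal{Z}_i=\{Z\in\mathcal{Z}(\mathcal{M})\mid Z\le Z_i\}$.
   Context: Let $\mathbb{F}=\mathbb{F}_q$. For a finite-dimensional $\mathbb{F}$-vector space $E$, $\mathcal{L}(E)$ is its subspace lattice. A $q$-matroid is $\mathcal{M}=(E,\rho)$ with $\rho:\mathcal{L}(E)\to\mathbb{Z}_{\ge0}$ satisfying $0\le\rho(V)\le\dim V$, monotonicity, and submodularity $\rho(V+W)+\rho(V\cap W)\le\rho(V)+\rho(W)$. A flat is $F$ with $\rho(F+\langle x\rangle)>\rho(F)$ for all $x\notin F$. The closure is $\mathrm{cl}(V)=\sum\{\langle x\rangle : x\in E,\ \rho(V+\langle x\rangle)=\rho(V)\}$. The cyclic core is $\mathrm{cyc}(V)=\{x\in V\mid\rho(W)=\rho(V)\text{ for all }W\le V\text{ with }W+\langle x\rangle=V\}$; $V$ is cyclic if $\mathrm{cyc}(V)=V$; $\mathcal{Z}(\mathcal{M})$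 is the set of cyclic flats. $\mathcal{M}$ is full if $\mathrm{cl}(0)=0$ and $\mathrm{cyc}(E)=E$. Direct sum: for $q$-matroids $\mathcal{M}_i=(E_i,\rho_i)$ and $E=E_1\oplus E_2$ with projections $\pi_i$, $\mathcal{M}_1\oplus\mathcal{M}_2=(E,\rho)$ with $\rho(V)=\dim V+\min_{X\le V}(\rho_1(\pi_1(X))+\rho_2(\pi_2(X))-\dim X)$; we write $\mathcal{M}=\mathcal{M}_1\oplus\mathcal{M}_2$ when $E$ is the internal direct sum of subspaces $E_1,E_2$ and the rank function of $\mathcal{M}$ equals this one. $\mathcal{M}$ is reducible if $\mathcal{M}=\mathcal{M}_1\oplus\mathcal{M}_2$ for some $q$-matroids $\mathcal{M}_1,\mathcal{M}_2$ with nonzero ground spaces, and irreducible otherwise. -}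

module Defs where

open import Level using (Level; Lift; lift; lower; _⊔_) renaming (suc to lsuc)
open import Algebra.Apartness.Bundles using (HeytingCommutativeRing; HeytingField)
open import Algebra.Bundles using (CommutativeMonoid; CommutativeRing)
open import Algebra.Module.Bundles using (Module; RawModule)
import Algebra.Module.Morphism.ModuleMonomorphism as ModuleMonomorphism
open import Algebra.Module.Morphism.Structures using (IsModuleHomomorphism; IsModuleMonomorphism)
import Algebra.Module.Properties as ModuleProperties
import Algebra.Properties.AbelianGroup as AbelianGroupProperties
import Algebra.Properties.CommutativeSemigroup as CommutativeSemigroupProperties
import Algebra.Properties.Monoid.Sum as MonoidSum
open import Data.Fin.Base using (Fin; zero; suc)
import Data.Fin.Properties as Fin
open import Data.Integer.Base as ℤ using (ℤ; +_)
open import Data.List.Base using (List; []; _∷_; [_]; allFin; cartesianProductWith; filter; foldr; map)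
open import Data.List.Membership.Propositional.Properties using (∈-allFin)
import Data.List.Membership.Setoid as SetoidMembership
import Data.List.Membership.Setoid.Properties as SetoidMembershipProperties
open import Data.List.Relation.Unary.Any as Any using (here; there)
open import Data.List.Relation.Unary.All as All using (All; []; _∷_)
open import Data.List.Relation.Unary.Enumerates.Setoid using (IsEnumeration)
open import Data.Nat.Base as ℕ using (ℕ; zero; suc; _+_; _≤_; _<_)
import Data.Nat.Properties as ℕ
open import Data.Product.Base using (Σ; ∃; ∃₂; _×_; _,_; proj₁; proj₂)
open import Data.Sum.Base using (_⊎_; inj₁; inj₂)
open import Data.Unit.Base using (tt)
open import Data.Unit.Polymorphic.Base using () renaming (⊤ to ⊤ᵖ; tt to ttᵖ)
open import Data.Vec.Functional using (Vector; head; tail) renaming (_∷_ to _∷ᵛ_; [] to []ᵛ)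
open import Function.Base using (id; _∘_; _on_)
open import Function.Bundles using (Inverse)
open import Relation.Binary.PropositionalEquality as ≡ using (_≡_)
import Relation.Binary.Reasoning.Setoid as SetoidReasoning
open import Relation.Nullary.Decidable.Core using (Dec; yes; no; map′; _×-dec_)
open import Relation.Nullary.Negation.Core using (¬_; contradiction)
open import Relation.Unary using (Pred; Decidable; U; _⊆_; _≐_; _∩_) renaming (_∈_ to _∈ᵖ_)
open import Relation.Binary.Core using (Rel)
open import Relation.Binary.Definitions using (_Respects_)

private
  variable
    c ℓ₁ ℓ₂ m ℓ p : Level

-- Apartness adds no data here: in a finite Heyting field equality is
-- decidable and x # y holds exactly when x ≈ y fails.
record FiniteField c ℓ₁ ℓ₂ : Set (lsuc (c ⊔ ℓ₁ ⊔ ℓ₂)) where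
  field
    heytingField : HeytingField c ℓ₁ ℓ₂

  open HeytingField heytingField public
  open HeytingCommutativeRing heytingCommutativeRing public using (commutativeRing)

  field
    order  : ℕ
    finite : Inverse setoid (≡.setoid (Fin order))

  open Inverse finite public using (to; from; to-cong; inverseʳ)

  scalars : List Carrier
  scalars = map from (allFin order)

  scalars-complete : IsEnumeration setoid scalars
  scalars-complete x = resp (inverseʳ ≡.refl)
    (SetoidMembershipProperties.∈-map⁺ (≡.setoid (Fin order)) setoid
      (λ { ≡.refl → refl }) (∈-allFin (to x)))
    where
    resp : ∀ {y} → y ≈ x → SetoidMembership._∈_ setoid y scalars → SetoidMembership._∈_ setoid x scalars
    resp y≈x = Any.map (trans (sym y≈x))

  _≈?_ : ∀ x y → Dec (x ≈ y)
  x ≈? y = map′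
    (λ eq → trans (sym (inverseʳ ≡.refl)) (trans (Inverse.from-cong finite eq) (inverseʳ ≡.refl)))
    to-cong (to x Fin.≟ to y)

  any-scalar? : {P : Pred Carrier p} → P Respects _≈_ → Decidable P → Dec (∃ P)
  any-scalar? resp P? = map′ Any.satisfied
    (λ (x , px) → Any.map (λ x≈y → resp x≈y px) (scalars-complete x))
    (Any.any? P? scalars)

  zero-or-invertible : ∀ x → x ≈ 0# ⊎ ∃ λ y → y * x ≈ 1#
  zero-or-invertible x with any-scalar? (λ y≈z → trans (*-congʳ (sym y≈z))) (λ y → (y * x) ≈? 1#)
  ... | yes inv = inj₂ inv
  ... | no ¬inv = inj₁ (proj₁ (tight x 0#) λ x#0 →
        let (y , yx≈1 , _) = #⇒invertible x#0
        in ¬inv (y , trans (*-congˡ (sym x-0≈x)) yx≈1))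
    where
    x-0≈x : x - 0# ≈ x
    x-0≈x = trans (+-congˡ (trans (sym (+-identityˡ _)) (-‿inverseʳ 0#))) (+-identityʳ x)

module _ {R : CommutativeRing c ℓ₁} (M : Module R m ℓ) where
  open CommutativeRing R using (Carrier; _≈_; 0#)
  open Module M
  open MonoidSum +ᴹ-monoid using (sum)

  linearCombination : ∀ {n} → Vector Carrier n → Vector Carrierᴹ n → Carrierᴹ
  linearCombination a b = sum λ i → a i *ₗ b i

  record IsBasis (P : Pred Carrierᴹ p) {n} (b : Vector Carrierᴹ n) : Set (c ⊔ ℓ₁ ⊔ m ⊔ ℓ ⊔ p) where
    field
      members     : ∀ i → b i ∈ᵖ P
      independent : ∀ a → linearCombination a b ≈ᴹ 0ᴹ → ∀ i → a i ≈ 0#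
      spanning    : ∀ {x} → x ∈ᵖ P → ∃ λ a → x ≈ᴹ linearCombination a b

record VectorSpace (F : FiniteField c ℓ₁ ℓ₂) m ℓ : Set (c ⊔ ℓ₁ ⊔ lsuc (m ⊔ ℓ)) where
  field
    vectors   : Module (FiniteField.commutativeRing F) m ℓ

  open Module vectors public

  field
    dimension : ℕ
    basis     : Vector Carrierᴹ dimension
    isBasis   : IsBasis vectors U basis

module _ {F : FiniteField c ℓ₁ ℓ₂} (E : VectorSpace F m ℓ) where
  open FiniteField F hiding (zero) renaming (_+_ to _+F_)
  open VectorSpace E
  open MonoidSum +ᴹ-monoid using (sum)
  open SetoidMembership ≈ᴹ-setoid using (_∈_)
  open AbelianGroupProperties +ᴹ-abelianGroup using (x∙y⁻¹≈ε⇒x≈y; x≈y⇒x∙y⁻¹≈ε)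
  open ModuleProperties vectors using (inverseˡ-uniqueᴹ)
  open SetoidReasoning ≈ᴹ-setoid

  -1*ₗ : ∀ x → (- 1#) *ₗ x ≈ᴹ -ᴹ x
  -1*ₗ x = inverseˡ-uniqueᴹ _ _ (begin
    (- 1#) *ₗ x +ᴹ x         ≈⟨ +ᴹ-congˡ (*ₗ-identityˡ x) ⟨
    (- 1#) *ₗ x +ᴹ 1# *ₗ x   ≈⟨ *ₗ-distribʳ x (- 1#) 1# ⟨
    ((- 1#) +F 1#) *ₗ x      ≈⟨ *ₗ-congʳ (-‿inverseˡ 1#) ⟩
    0# *ₗ x                  ≈⟨ *ₗ-zeroˡ x ⟩
    0ᴹ                       ∎)

  private
    lc : ∀ {n} → Vector Carrier n → Vector Carrierᴹ n → Carrierᴹ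
    lc = linearCombination vectors

  lc-zero : ∀ {n} (a : Vector Carrier n) b → (∀ i → a i ≈ 0#) → lc a b ≈ᴹ 0ᴹ
  lc-zero {zero}  a b a≈0 = ≈ᴹ-refl
  lc-zero {suc n} a b a≈0 = begin
    a zero *ₗ b zero +ᴹ lc (tail a) (tail b)
      ≈⟨ +ᴹ-cong (*ₗ-congʳ (a≈0 zero)) (lc-zero (tail a) (tail b) (a≈0 ∘ suc)) ⟩
    0# *ₗ b zero +ᴹ 0ᴹ   ≈⟨ +ᴹ-identityʳ _ ⟩
    0# *ₗ b zero         ≈⟨ *ₗ-zeroˡ _ ⟩
    0ᴹ                   ∎

  lc-scale : ∀ {n} s (a : Vector Carrier n) b → s *ₗ lc a b ≈ᴹ lc (λ i → s * a i) b
  lc-scale {zero}  s a b = *ₗ-zeroʳ s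
  lc-scale {suc n} s a b = ≈ᴹ-trans (*ₗ-distribˡ s _ _)
    (+ᴹ-cong (≈ᴹ-sym (*ₗ-assoc s _ _)) (lc-scale s (tail a) (tail b)))

  combinations : ∀ {n} → Vector Carrierᴹ n → List Carrierᴹ
  combinations {zero}  b = [ 0ᴹ ]
  combinations {suc n} b =
    cartesianProductWith (λ s y → s *ₗ head b +ᴹ y) scalars (combinations (tail b))

  ∈-combinations : ∀ {n} (b : Vector Carrierᴹ n) a → lc a b ∈ combinations b
  ∈-combinations {zero}  b a = here ≈ᴹ-refl
  ∈-combinations {suc n} b a =
    SetoidMembershipProperties.∈-cartesianProductWith⁺ setoid ≈ᴹ-setoid ≈ᴹ-setoid
      (λ s≈t y≈z → +ᴹ-cong (*ₗ-congʳ s≈t) y≈z)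
      (scalars-complete (a zero)) (∈-combinations (tail b) (tail a))

  combinations-∈ : ∀ {n} (b : Vector Carrierᴹ n) {x} → x ∈ combinations b → ∃ λ a → x ≈ᴹ lc a b
  combinations-∈ {zero}  b (here x≈0) = []ᵛ , x≈0
  combinations-∈ {suc n} b x∈ =
    let (s , y , _ , y∈ , x≈sb+y) = SetoidMembershipProperties.∈-cartesianProductWith⁻
          setoid ≈ᴹ-setoid ≈ᴹ-setoid _ scalars (combinations (tail b)) x∈
        (a , y≈ab) = combinations-∈ (tail b) y∈
    in (s ∷ᵛ a) , ≈ᴹ-trans x≈sb+y (+ᴹ-congˡ y≈ab)

  elements : List Carrierᴹ
  elements = combinations basis

  elements-complete : IsEnumeration ≈ᴹ-setoid elements
  elements-complete x =
    let (a , x≈ab) = IsBasis.spanning isBasis {x} tt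
    in Any.map (≈ᴹ-trans x≈ab) (∈-combinations basis a)

  any-element? : {P : Pred Carrierᴹ p} → P Respects _≈ᴹ_ → Decidable P → Dec (∃ P)
  any-element? resp P? = map′ Any.satisfied
    (λ (x , px) → Any.map (λ x≈y → resp x≈y px) (elements-complete x))
    (Any.any? P? elements)

  _≈ᴹ?_ : ∀ x y → Dec (x ≈ᴹ y)
  x ≈ᴹ? y =
    let (a , d≈ab) = IsBasis.spanning isBasis {x +ᴹ -ᴹ y} tt
    in map′
      (λ a≈0 → x∙y⁻¹≈ε⇒x≈y x y (≈ᴹ-trans d≈ab (lc-zero a basis a≈0)))
      (λ x≈y → IsBasis.independent isBasis a (≈ᴹ-trans (≈ᴹ-sym d≈ab) (x≈y⇒x∙y⁻¹≈ε x≈y)))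
      (Fin.all? λ i → a i ≈? 0#)

  span? : ∀ {n} (b : Vector Carrierᴹ n) x → Dec (∃ λ a → x ≈ᴹ lc a b)
  span? b x = map′ (combinations-∈ b)
    (λ (a , x≈ab) → Any.map (≈ᴹ-trans x≈ab) (∈-combinations b a))
    (Any.any? (x ≈ᴹ?_) (combinations b))

  extend-independent : ∀ {n} (b : Vector Carrierᴹ n) x →
    (∀ a → lc a b ≈ᴹ 0ᴹ → ∀ i → a i ≈ 0#) → ¬ (∃ λ a → x ≈ᴹ lc a b) →
    ∀ a → lc a (x ∷ᵛ b) ≈ᴹ 0ᴹ → ∀ i → a i ≈ 0#
  extend-independent b x indep x∉ a eq with zero-or-invertible (a zero)
  ... | inj₁ a₀≈0 = λ { zero → a₀≈0 ; (suc i) → indep (tail a) rest≈0 i }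
    where
    rest≈0 : lc (tail a) b ≈ᴹ 0ᴹ
    rest≈0 = begin
      lc (tail a) b                    ≈⟨ +ᴹ-identityˡ _ ⟨
      0ᴹ +ᴹ lc (tail a) b              ≈⟨ +ᴹ-congʳ (*ₗ-zeroˡ x) ⟨
      0# *ₗ x +ᴹ lc (tail a) b         ≈⟨ +ᴹ-congʳ (*ₗ-congʳ a₀≈0) ⟨
      a zero *ₗ x +ᴹ lc (tail a) b     ≈⟨ eq ⟩
      0ᴹ                               ∎
  ... | inj₂ (u , ua₀≈1) = contradiction (_ , x≈) x∉
    where
    x≈ : x ≈ᴹ lc (λ i → (u * (- 1#)) * a (suc i)) b
    x≈ = begin
      x                                ≈⟨ *ₗ-identityˡ x ⟨
      1# *ₗ x                          ≈⟨ *ₗ-congʳ ua₀≈1 ⟨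
      (u * a zero) *ₗ x                ≈⟨ *ₗ-assoc u (a zero) x ⟩
      u *ₗ a zero *ₗ x                 ≈⟨ *ₗ-congˡ (inverseˡ-uniqueᴹ _ _ eq) ⟩
      u *ₗ (-ᴹ lc (tail a) b)          ≈⟨ *ₗ-congˡ (-1*ₗ _) ⟨
      u *ₗ (- 1#) *ₗ lc (tail a) b     ≈⟨ *ₗ-assoc u (- 1#) _ ⟨
      (u * (- 1#)) *ₗ lc (tail a) b    ≈⟨ lc-scale (u * (- 1#)) (tail a) b ⟩
      lc (λ i → (u * (- 1#)) * a (suc i)) b ∎

  -- Membership is required to be decidable: this holds classically, and
  -- makes the dimension and the sum of subspaces computable.  The
  -- predicate level is the least one closed under the operations below.
  record Subspace : Set (lsuc (c ⊔ m ⊔ ℓ)) where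
    field
      mem       : Pred Carrierᴹ (c ⊔ m ⊔ ℓ)
      mem?      : Decidable mem
      mem-resp  : mem Respects _≈ᴹ_
      0ᴹ-closed : mem 0ᴹ
      +ᴹ-closed : ∀ {x y} → mem x → mem y → mem (x +ᴹ y)
      *ₗ-closed : ∀ s {x} → mem x → mem (s *ₗ x)

    -ᴹ-closed : ∀ {x} → mem x → mem (-ᴹ x)
    -ᴹ-closed {x} x∈ = mem-resp (-1*ₗ x) (*ₗ-closed (- 1#) x∈)

    *ᵣ-closed : ∀ s {x} → mem x → mem (x *ᵣ s)
    *ᵣ-closed s {x} x∈ = mem-resp (*ₗ-*ᵣ-coincident s x) (*ₗ-closed s x∈)

open Subspace using (mem)

module _ {F : FiniteField c ℓ₁ ℓ₂} {E : VectorSpace F m ℓ} where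
  open FiniteField F using (Carrier; 0#; 1#; scalars; any-scalar?) renaming (_+_ to _+F_; _*_ to _*F_)
  open VectorSpace E
  open SetoidReasoning ≈ᴹ-setoid
  open CommutativeSemigroupProperties (CommutativeMonoid.commutativeSemigroup +ᴹ-commutativeMonoid)
    using (interchange)

  infix  4 _∈ₛ_ _≤ₛ_ _≈ₛ_
  infixl 6 _+ₛ_
  infixl 7 _∩ₛ_

  _∈ₛ_ : Carrierᴹ → Subspace E → Set (c ⊔ m ⊔ ℓ)
  x ∈ₛ V = mem V x

  _≤ₛ_ : Rel (Subspace E) (c ⊔ m ⊔ ℓ)
  V ≤ₛ W = mem V ⊆ mem W

  _≈ₛ_ : Rel (Subspace E) (c ⊔ m ⊔ ℓ)
  V ≈ₛ W = mem V ≐ mem W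

  ⊤ₛ : Subspace E
  ⊤ₛ = record
    { mem       = λ _ → ⊤ᵖ
    ; mem?      = λ _ → yes ttᵖ
    ; mem-resp  = λ _ _ → ttᵖ
    ; 0ᴹ-closed = ttᵖ
    ; +ᴹ-closed = λ _ _ → ttᵖ
    ; *ₗ-closed = λ _ _ → ttᵖ
    }

  ⊥ₛ : Subspace E
  ⊥ₛ = record
    { mem       = λ x → Lift (c ⊔ m) (x ≈ᴹ 0ᴹ)
    ; mem?      = λ x → map′ lift lower (_≈ᴹ?_ E x 0ᴹ)
    ; mem-resp  = λ x≈y (lift x≈0) → lift (≈ᴹ-trans (≈ᴹ-sym x≈y) x≈0)
    ; 0ᴹ-closed = lift ≈ᴹ-refl
    ; +ᴹ-closed = λ (lift x≈0) (lift y≈0) → lift (≈ᴹ-trans (+ᴹ-cong x≈0 y≈0) (+ᴹ-identityˡ 0ᴹ))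
    ; *ₗ-closed = λ s (lift x≈0) → lift (≈ᴹ-trans (*ₗ-congˡ x≈0) (*ₗ-zeroʳ s))
    }

  ⟨_⟩ : Carrierᴹ → Subspace E
  ⟨ x ⟩ = record
    { mem       = λ y → Lift m (∃ λ s → y ≈ᴹ s *ₗ x)
    ; mem?      = λ y → map′ lift lower
        (any-scalar? (λ s≈t y≈sx → ≈ᴹ-trans y≈sx (*ₗ-congʳ s≈t)) (λ s → _≈ᴹ?_ E y (s *ₗ x)))
    ; mem-resp  = λ y≈z (lift (s , y≈sx)) → lift (s , ≈ᴹ-trans (≈ᴹ-sym y≈z) y≈sx)
    ; 0ᴹ-closed = lift (0# , ≈ᴹ-sym (*ₗ-zeroˡ x))
    ; +ᴹ-closed = λ (lift (s , y≈)) (lift (t , z≈)) →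
        lift (s +F t , ≈ᴹ-trans (+ᴹ-cong y≈ z≈) (≈ᴹ-sym (*ₗ-distribʳ x s t)))
    ; *ₗ-closed = λ t (lift (s , y≈)) →
        lift (t *F s , ≈ᴹ-trans (*ₗ-congˡ y≈) (≈ᴹ-sym (*ₗ-assoc t s x)))
    }

  _∩ₛ_ : Subspace E → Subspace E → Subspace E
  V ∩ₛ W = record
    { mem       = mem V ∩ mem W
    ; mem?      = λ x → V.mem? x ×-dec W.mem? x
    ; mem-resp  = λ x≈y (x∈V , x∈W) → V.mem-resp x≈y x∈V , W.mem-resp x≈y x∈W
    ; 0ᴹ-closed = V.0ᴹ-closed , W.0ᴹ-closed
    ; +ᴹ-closed = λ (x∈V , x∈W) (y∈V , y∈W) → V.+ᴹ-closed x∈V y∈V , W.+ᴹ-closed x∈W y∈W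
    ; *ₗ-closed = λ s (x∈V , x∈W) → V.*ₗ-closed s x∈V , W.*ₗ-closed s x∈W
    }
    where
    module V = Subspace V
    module W = Subspace W

  _+ₛ_ : Subspace E → Subspace E → Subspace E
  V +ₛ W = record
    { mem       = λ x → ∃₂ λ v w → v ∈ₛ V × w ∈ₛ W × x ≈ᴹ v +ᴹ w
    ; mem?      = λ x → any-element? E
        (λ v≈v′ (w , v∈ , w∈ , x≈) →
          w , V.mem-resp v≈v′ v∈ , w∈ , ≈ᴹ-trans x≈ (+ᴹ-congʳ v≈v′))
        (λ v → any-element? E
          (λ w≈w′ (v∈ , w∈ , x≈) →
            v∈ , W.mem-resp w≈w′ w∈ , ≈ᴹ-trans x≈ (+ᴹ-congˡ w≈w′))
          (λ w → V.mem? v ×-dec W.mem? w ×-dec _≈ᴹ?_ E x (v +ᴹ w)))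
    ; mem-resp  = λ x≈y (v , w , v∈ , w∈ , x≈) → v , w , v∈ , w∈ , ≈ᴹ-trans (≈ᴹ-sym x≈y) x≈
    ; 0ᴹ-closed = 0ᴹ , 0ᴹ , V.0ᴹ-closed , W.0ᴹ-closed , ≈ᴹ-sym (+ᴹ-identityˡ 0ᴹ)
    ; +ᴹ-closed = λ (v , w , v∈ , w∈ , x≈) (v′ , w′ , v′∈ , w′∈ , y≈) →
        v +ᴹ v′ , w +ᴹ w′ , V.+ᴹ-closed v∈ v′∈ , W.+ᴹ-closed w∈ w′∈ ,
        ≈ᴹ-trans (+ᴹ-cong x≈ y≈) (interchange v w v′ w′)
    ; *ₗ-closed = λ s (v , w , v∈ , w∈ , x≈) →
        s *ₗ v , s *ₗ w , V.*ₗ-closed s v∈ , W.*ₗ-closed s w∈ ,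
        ≈ᴹ-trans (*ₗ-congˡ x≈) (*ₗ-distribˡ s v w)
    }
    where
    module V = Subspace V
    module W = Subspace W

  sumₛ : List (Subspace E) → Subspace E
  sumₛ = foldr _+ₛ_ ⊥ₛ

  Spanned : ∀ {n} → Vector Carrierᴹ n → Pred Carrierᴹ (c ⊔ ℓ)
  Spanned b x = ∃ λ a → x ≈ᴹ linearCombination vectors a b

  spanned-head : ∀ {n} (b : Vector Carrierᴹ n) x → Spanned (x ∷ᵛ b) x
  spanned-head b x = 1# ∷ᵛ (λ _ → 0#) , (begin
    x                                                    ≈⟨ *ₗ-identityˡ x ⟨
    1# *ₗ x                                              ≈⟨ +ᴹ-identityʳ _ ⟨
    1# *ₗ x +ᴹ 0ᴹ
      ≈⟨ +ᴹ-congˡ (lc-zero E (λ _ → 0#) b (λ _ → FiniteField.refl F)) ⟨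
    1# *ₗ x +ᴹ linearCombination vectors (λ _ → 0#) b    ∎)

  spanned-tail : ∀ {n} (b : Vector Carrierᴹ n) x {y} → Spanned b y → Spanned (x ∷ᵛ b) y
  spanned-tail b x {y} (a , y≈) = 0# ∷ᵛ a , (begin
    y                                           ≈⟨ y≈ ⟩
    linearCombination vectors a b               ≈⟨ +ᴹ-identityˡ _ ⟨
    0ᴹ +ᴹ linearCombination vectors a b         ≈⟨ +ᴹ-congʳ (*ₗ-zeroˡ x) ⟨
    0# *ₗ x +ᴹ linearCombination vectors a b    ∎)

  -- The basis found depends on an enumeration of E, but the number of its
  -- elements does not.
  hasBasis : (V : Subspace E) → ∃ λ n → ∃ λ (b : Vector Carrierᴹ n) → IsBasis vectors (mem V) b
  hasBasis V =
    let (n , b , b∈ , indep , covers) = grow (elements E)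
    in n , b , record
      { members     = b∈
      ; independent = indep
      ; spanning    = λ {x} x∈ →
          let (covered , x≈y) = All.lookupAny covers (elements-complete E x)
              (a , y≈)        = covered (V.mem-resp x≈y x∈)
          in a , ≈ᴹ-trans x≈y y≈
      }
    where
    module V = Subspace V
    grow : (xs : List Carrierᴹ) → ∃ λ n → ∃ λ (b : Vector Carrierᴹ n) →
      (∀ i → b i ∈ₛ V) ×
      (∀ a → linearCombination vectors a b ≈ᴹ 0ᴹ → ∀ i → FiniteField._≈_ F (a i) 0#) ×
      All (λ x → x ∈ₛ V → Spanned b x) xs
    grow [] = 0 , []ᵛ , (λ ()) , (λ _ _ ()) , []
    grow (x ∷ xs) with grow xs
    ... | n , b , b∈ , indep , covers with V.mem? x
    ... | no x∉ = n , b , b∈ , indep , (λ x∈ → contradiction x∈ x∉) ∷ covers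
    ... | yes x∈ with span? E b x
    ... | yes spanned = n , b , b∈ , indep , (λ _ → spanned) ∷ covers
    ... | no ¬spanned =
      suc n , x ∷ᵛ b ,
      (λ { zero → x∈ ; (suc i) → b∈ i }) ,
      extend-independent E b x indep ¬spanned ,
      (λ _ → spanned-head b x) ∷ All.map (λ covered y∈ → spanned-tail b x (covered y∈)) covers

  dim : Subspace E → ℕ
  dim V = proj₁ (hasBasis V)

  subspaceModule : Subspace E → Module (FiniteField.commutativeRing F) (c ⊔ m ⊔ ℓ) ℓ
  subspaceModule V = record
    { isModule = ModuleMonomorphism.isModule inclusion (FiniteField.isCommutativeRing F) isModule }
    where
    module V = Subspace V
    raw : RawModule Carrier (c ⊔ m ⊔ ℓ) ℓ
    raw = record
      { Carrierᴹ = ∃ (mem V)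
      ; _≈ᴹ_     = _≈ᴹ_ on proj₁
      ; _+ᴹ_     = λ (x , x∈) (y , y∈) → x +ᴹ y , V.+ᴹ-closed x∈ y∈
      ; _*ₗ_     = λ s (x , x∈) → s *ₗ x , V.*ₗ-closed s x∈
      ; _*ᵣ_     = λ (x , x∈) s → x *ᵣ s , V.*ᵣ-closed s x∈
      ; 0ᴹ       = 0ᴹ , V.0ᴹ-closed
      ; -ᴹ_      = λ (x , x∈) → -ᴹ x , V.-ᴹ-closed x∈
      }
    inclusion : IsModuleMonomorphism raw rawModule proj₁
    inclusion = record
      { isModuleHomomorphism = record { isBimoduleHomomorphism = record
        { +ᴹ-isGroupHomomorphism = record
          { isMonoidHomomorphism = record
            { isMagmaHomomorphism = record
              { isRelHomomorphism = record { cong = id }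
              ; homo              = λ _ _ → ≈ᴹ-refl }
            ; ε-homo = ≈ᴹ-refl }
          ; ⁻¹-homo = λ _ → ≈ᴹ-refl }
        ; *ₗ-homo = λ _ _ → ≈ᴹ-refl
        ; *ᵣ-homo = λ _ _ → ≈ᴹ-refl } }
      ; injective = id
      }

  asSpace : Subspace E → VectorSpace F (c ⊔ m ⊔ ℓ) ℓ
  asSpace V = record
    { vectors   = subspaceModule V
    ; dimension = dim V
    ; basis     = b′
    ; isBasis   = record
      { members     = λ _ → tt
      ; independent = λ a ab≈0 → B.independent a (≡.subst (_≈ᴹ 0ᴹ) (lc-proj₁ a b′) ab≈0)
      ; spanning    = λ {x} _ →
          let (a , x≈ab) = B.spanning (proj₂ x)
          in a , ≡.subst (proj₁ x ≈ᴹ_) (≡.sym (lc-proj₁ a b′)) x≈ab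
      }
    }
    where
    module B = IsBasis (proj₂ (proj₂ (hasBasis V)))
    b′ : Vector (∃ (mem V)) (dim V)
    b′ i = proj₁ (proj₂ (hasBasis V)) i , B.members i
    lc-proj₁ : ∀ {n} (a : Vector Carrier n) (b : Vector (∃ (mem V)) n) →
      proj₁ (linearCombination (subspaceModule V) a b) ≡ linearCombination vectors a (proj₁ ∘ b)
    lc-proj₁ {zero}  a b = ≡.refl
    lc-proj₁ {suc n} a b = ≡.cong (a zero *ₗ proj₁ (b zero) +ᴹ_) (lc-proj₁ (tail a) (tail b))

module _ {F : FiniteField c ℓ₁ ℓ₂} {E : VectorSpace F m ℓ} {E′ : VectorSpace F (c ⊔ m ⊔ ℓ) ℓ} where
  private
    module E  = VectorSpace E
    module E′ = VectorSpace E′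

  image : (f : E.Carrierᴹ → E′.Carrierᴹ) → IsModuleHomomorphism E.rawModule E′.rawModule f →
          Subspace E → Subspace E′
  image f f-linear X = record
    { mem       = λ y → ∃ λ x → x ∈ₛ X × y E′.≈ᴹ f x
    ; mem?      = λ y → any-element? E
        (λ x≈x′ (x∈ , y≈) → X.mem-resp x≈x′ x∈ , E′.≈ᴹ-trans y≈ (f.⟦⟧-cong x≈x′))
        (λ x → X.mem? x ×-dec _≈ᴹ?_ E′ y (f x))
    ; mem-resp  = λ y≈z (x , x∈ , y≈) → x , x∈ , E′.≈ᴹ-trans (E′.≈ᴹ-sym y≈z) y≈
    ; 0ᴹ-closed = E.0ᴹ , X.0ᴹ-closed , E′.≈ᴹ-sym f.0ᴹ-homo
    ; +ᴹ-closed = λ (x , x∈ , y≈) (x′ , x′∈ , z≈) →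
        x E.+ᴹ x′ , X.+ᴹ-closed x∈ x′∈ ,
        E′.≈ᴹ-trans (E′.+ᴹ-cong y≈ z≈) (E′.≈ᴹ-sym (f.+ᴹ-homo x x′))
    ; *ₗ-closed = λ s (x , x∈ , y≈) →
        s E.*ₗ x , X.*ₗ-closed s x∈ ,
        E′.≈ᴹ-trans (E′.*ₗ-congˡ y≈) (E′.≈ᴹ-sym (f.*ₗ-homo s x))
    }
    where
    module X = Subspace X
    module f = IsModuleHomomorphism f-linear

module _ {F : FiniteField c ℓ₁ ℓ₂} {E : VectorSpace F m ℓ} where
  open VectorSpace E
  open AbelianGroupProperties +ᴹ-abelianGroup
  open CommutativeSemigroupProperties (CommutativeMonoid.commutativeSemigroup +ᴹ-commutativeMonoid)
    using (interchange)

  -- E is the internal direct sum of V and W.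
  record IsDirectDecomposition (V W : Subspace E) : Set (c ⊔ m ⊔ ℓ) where
    field
      sum≈⊤          : V +ₛ W ≈ₛ ⊤ₛ
      intersection≈⊥ : V ∩ₛ W ≈ₛ ⊥ₛ

    -- The choice of summands in the sum is unique up to ≈ᴹ, see `unique`.
    π₁ : Carrierᴹ → VectorSpace.Carrierᴹ (asSpace V)
    π₁ x = let (v , _ , v∈ , _) = proj₂ sum≈⊤ {x} ttᵖ in v , v∈

    π₂ : Carrierᴹ → VectorSpace.Carrierᴹ (asSpace W)
    π₂ x = let (_ , w , _ , w∈ , _) = proj₂ sum≈⊤ {x} ttᵖ in w , w∈

    π-decompose : ∀ x → x ≈ᴹ proj₁ (π₁ x) +ᴹ proj₁ (π₂ x)
    π-decompose x = let (_ , _ , _ , _ , x≈) = proj₂ sum≈⊤ {x} ttᵖ in x≈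

    unique : ∀ {v v′ w w′} → v ∈ₛ V → v′ ∈ₛ V → w ∈ₛ W → w′ ∈ₛ W →
             v +ᴹ w ≈ᴹ v′ +ᴹ w′ → v ≈ᴹ v′ × w ≈ᴹ w′
    unique {v} {v′} {w} {w′} v∈ v′∈ w∈ w′∈ eq = v≈v′ , w≈w′
      where
      open SetoidReasoning ≈ᴹ-setoid
      module V = Subspace V
      module W = Subspace W
      difference : v +ᴹ -ᴹ v′ ≈ᴹ w′ +ᴹ -ᴹ w
      difference = begin
        v +ᴹ -ᴹ v′                          ≈⟨ +ᴹ-identityʳ _ ⟨
        (v +ᴹ -ᴹ v′) +ᴹ 0ᴹ                  ≈⟨ +ᴹ-congˡ (-ᴹ‿inverseʳ w) ⟨
        (v +ᴹ -ᴹ v′) +ᴹ (w +ᴹ -ᴹ w)         ≈⟨ interchange v (-ᴹ v′) w (-ᴹ w) ⟩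
        (v +ᴹ w) +ᴹ (-ᴹ v′ +ᴹ -ᴹ w)         ≈⟨ +ᴹ-congʳ eq ⟩
        (v′ +ᴹ w′) +ᴹ (-ᴹ v′ +ᴹ -ᴹ w)       ≈⟨ interchange v′ w′ (-ᴹ v′) (-ᴹ w) ⟩
        (v′ +ᴹ -ᴹ v′) +ᴹ (w′ +ᴹ -ᴹ w)       ≈⟨ +ᴹ-congʳ (-ᴹ‿inverseʳ v′) ⟩
        0ᴹ +ᴹ (w′ +ᴹ -ᴹ w)                  ≈⟨ +ᴹ-identityˡ _ ⟩
        w′ +ᴹ -ᴹ w                          ∎
      difference≈0 : v +ᴹ -ᴹ v′ ≈ᴹ 0ᴹ
      difference≈0 = lower (proj₁ intersection≈⊥
        ( V.+ᴹ-closed v∈ (V.-ᴹ-closed v′∈)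
        , W.mem-resp (≈ᴹ-sym difference) (W.+ᴹ-closed w′∈ (W.-ᴹ-closed w∈))))
      v≈v′ : v ≈ᴹ v′
      v≈v′ = x∙y⁻¹≈ε⇒x≈y v v′ difference≈0
      w≈w′ : w ≈ᴹ w′
      w≈w′ = ≈ᴹ-sym (x∙y⁻¹≈ε⇒x≈y w′ w (≈ᴹ-trans (≈ᴹ-sym difference) difference≈0))

    private
      v∈ : ∀ x → proj₁ (π₁ x) ∈ₛ V
      v∈ x = proj₂ (π₁ x)
      w∈ : ∀ x → proj₁ (π₂ x) ∈ₛ W
      w∈ x = proj₂ (π₂ x)
      module V = Subspace V
      module W = Subspace W

    π-cong : ∀ {x y} → x ≈ᴹ y → proj₁ (π₁ x) ≈ᴹ proj₁ (π₁ y) × proj₁ (π₂ x) ≈ᴹ proj₁ (π₂ y)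
    π-cong {x} {y} x≈y = unique (v∈ x) (v∈ y) (w∈ x) (w∈ y)
      (≈ᴹ-trans (≈ᴹ-sym (π-decompose x)) (≈ᴹ-trans x≈y (π-decompose y)))

    π-unique : ∀ {x v w} → v ∈ₛ V → w ∈ₛ W → x ≈ᴹ v +ᴹ w →
               proj₁ (π₁ x) ≈ᴹ v × proj₁ (π₂ x) ≈ᴹ w
    π-unique {x} v∈V w∈W x≈ = unique (v∈ x) v∈V (w∈ x) w∈W (≈ᴹ-trans (≈ᴹ-sym (π-decompose x)) x≈)

    π-+ : ∀ x y → proj₁ (π₁ (x +ᴹ y)) ≈ᴹ proj₁ (π₁ x) +ᴹ proj₁ (π₁ y) ×
                  proj₁ (π₂ (x +ᴹ y)) ≈ᴹ proj₁ (π₂ x) +ᴹ proj₁ (π₂ y)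
    π-+ x y = π-unique (V.+ᴹ-closed (v∈ x) (v∈ y)) (W.+ᴹ-closed (w∈ x) (w∈ y))
      (≈ᴹ-trans (+ᴹ-cong (π-decompose x) (π-decompose y)) (interchange _ _ _ _))

    π-0 : proj₁ (π₁ 0ᴹ) ≈ᴹ 0ᴹ × proj₁ (π₂ 0ᴹ) ≈ᴹ 0ᴹ
    π-0 = π-unique V.0ᴹ-closed W.0ᴹ-closed (≈ᴹ-sym (+ᴹ-identityˡ 0ᴹ))

    π-neg : ∀ x → proj₁ (π₁ (-ᴹ x)) ≈ᴹ -ᴹ proj₁ (π₁ x) × proj₁ (π₂ (-ᴹ x)) ≈ᴹ -ᴹ proj₁ (π₂ x)
    π-neg x = π-unique (V.-ᴹ-closed (v∈ x)) (W.-ᴹ-closed (w∈ x))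
      (≈ᴹ-trans (-ᴹ‿cong (π-decompose x)) (≈ᴹ-sym (⁻¹-∙-comm _ _)))

    π-*ₗ : ∀ s x → proj₁ (π₁ (s *ₗ x)) ≈ᴹ s *ₗ proj₁ (π₁ x) ×
                   proj₁ (π₂ (s *ₗ x)) ≈ᴹ s *ₗ proj₁ (π₂ x)
    π-*ₗ s x = π-unique (V.*ₗ-closed s (v∈ x)) (W.*ₗ-closed s (w∈ x))
      (≈ᴹ-trans (*ₗ-congˡ (π-decompose x)) (*ₗ-distribˡ s _ _))

    π-*ᵣ : ∀ s x → proj₁ (π₁ (x *ᵣ s)) ≈ᴹ proj₁ (π₁ x) *ᵣ s ×
                   proj₁ (π₂ (x *ᵣ s)) ≈ᴹ proj₁ (π₂ x) *ᵣ s
    π-*ᵣ s x = π-unique (V.*ᵣ-closed s (v∈ x)) (W.*ᵣ-closed s (w∈ x))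
      (≈ᴹ-trans (*ᵣ-congʳ (π-decompose x)) (*ᵣ-distribʳ s _ _))

    π₁-linear : IsModuleHomomorphism rawModule (VectorSpace.rawModule (asSpace V)) π₁
    π₁-linear = record { isBimoduleHomomorphism = record
      { +ᴹ-isGroupHomomorphism = record
        { isMonoidHomomorphism = record
          { isMagmaHomomorphism = record
            { isRelHomomorphism = record { cong = λ x≈y → proj₁ (π-cong x≈y) }
            ; homo              = λ x y → proj₁ (π-+ x y) }
          ; ε-homo = proj₁ π-0 }
        ; ⁻¹-homo = λ x → proj₁ (π-neg x) }
      ; *ₗ-homo = λ s x → proj₁ (π-*ₗ s x)
      ; *ᵣ-homo = λ s x → proj₁ (π-*ᵣ s x) } }

    π₂-linear : IsModuleHomomorphism rawModule (VectorSpace.rawModule (asSpace W)) π₂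
    π₂-linear = record { isBimoduleHomomorphism = record
      { +ᴹ-isGroupHomomorphism = record
        { isMonoidHomomorphism = record
          { isMagmaHomomorphism = record
            { isRelHomomorphism = record { cong = λ x≈y → proj₂ (π-cong x≈y) }
            ; homo              = λ x y → proj₂ (π-+ x y) }
          ; ε-homo = proj₂ π-0 }
        ; ⁻¹-homo = λ x → proj₂ (π-neg x) }
      ; *ₗ-homo = λ s x → proj₂ (π-*ₗ s x)
      ; *ᵣ-homo = λ s x → proj₂ (π-*ᵣ s x) } }

    π₁[_] : Subspace E → Subspace (asSpace V)
    π₁[_] = image π₁ π₁-linear

    π₂[_] : Subspace E → Subspace (asSpace W)
    π₂[_] = image π₂ π₂-linear

record QMatroid {F : FiniteField c ℓ₁ ℓ₂} (E : VectorSpace F m ℓ) : Set (lsuc (c ⊔ m ⊔ ℓ)) where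
  field
    ρ          : Subspace E → ℕ
    bounded    : ∀ V → ρ V ≤ dim V
    -- Taking V ≤ₛ W ≤ₛ V, this also makes ρ respect equality of subspaces.
    monotone   : ∀ {V W} → V ≤ₛ W → ρ V ≤ ρ W
    submodular : ∀ V W → ρ (V +ₛ W) + ρ (V ∩ₛ W) ≤ ρ V + ρ W

  open VectorSpace E using (Carrierᴹ)

  IsFlat : Subspace E → Set (c ⊔ m ⊔ ℓ)
  IsFlat V = ∀ {x} → ¬ x ∈ₛ V → ρ V < ρ (V +ₛ ⟨ x ⟩)

  -- The list `elements` contains every vector of E up to ≈ᴹ, so this is the
  -- sum over all x with ρ(V + ⟨x⟩) = ρ(V); repetitions do not matter.
  cl : Subspace E → Subspace E
  cl V = sumₛ (map ⟨_⟩ (filter (λ x → ρ (V +ₛ ⟨ x ⟩) ℕ.≟ ρ V) (elements E)))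

  cyc : Subspace E → Pred Carrierᴹ (lsuc (c ⊔ m ⊔ ℓ))
  cyc V x = x ∈ₛ V × (∀ W → W ≤ₛ V → W +ₛ ⟨ x ⟩ ≈ₛ V → ρ W ≡ ρ V)

  IsCyclic : Subspace E → Set (lsuc (c ⊔ m ⊔ ℓ))
  IsCyclic V = cyc V ≐ mem V

  𝒵 : Pred (Subspace E) (lsuc (c ⊔ m ⊔ ℓ))
  𝒵 V = IsFlat V × IsCyclic V

  IsFull : Set (lsuc (c ⊔ m ⊔ ℓ))
  IsFull = cl ⊥ₛ ≈ₛ ⊥ₛ × cyc ⊤ₛ ≐ mem {E = E} ⊤ₛ

module _ {F : FiniteField c ℓ₁ ℓ₂} {E : VectorSpace F m ℓ} where
  open QMatroid using (ρ)

  IsMinimumBelow : (V : Subspace E) → (Subspace E → ℤ) → ℤ → Set (lsuc (c ⊔ m ⊔ ℓ))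
  IsMinimumBelow V f μ = (∃ λ X → X ≤ₛ V × f X ≡ μ) × (∀ X → X ≤ₛ V → μ ℤ.≤ f X)

  -- The minimum is taken in ℤ.  ρ M is compared with the rank function of
  -- M₁ ⊕ M₂ at every V; that this function is a rank function is not assumed.
  IsDirectSum : QMatroid E → {E₁ E₂ : Subspace E} → IsDirectDecomposition E₁ E₂ →
                QMatroid (asSpace E₁) → QMatroid (asSpace E₂) → Set (lsuc (c ⊔ m ⊔ ℓ))
  IsDirectSum M E₁⊕E₂ M₁ M₂ = ∀ V → ∃ λ μ →
    IsMinimumBelow V (λ X → + (ρ M₁ π₁[ X ] + ρ M₂ π₂[ X ]) ℤ.- + dim X) μ ×
    + ρ M V ≡ + dim V ℤ.+ μ
    where open IsDirectDecomposition E₁⊕E₂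

  IsReducible : QMatroid E → Set (lsuc (c ⊔ m ⊔ ℓ))
  IsReducible M =
    ∃₂ λ (E₁ E₂ : Subspace E) → ¬ (E₁ ≈ₛ ⊥ₛ) × ¬ (E₂ ≈ₛ ⊥ₛ) ×
    Σ (IsDirectDecomposition E₁ E₂) λ E₁⊕E₂ →
    ∃₂ λ (M₁ : QMatroid (asSpace E₁)) (M₂ : QMatroid (asSpace E₂)) →
    IsDirectSum M E₁⊕E₂ M₁ M₂

  IsIrreducible : QMatroid E → Set (lsuc (c ⊔ m ⊔ ℓ))
  IsIrreducible M = ¬ IsReducible M

{-# OPTIONS --safe #-}

-- M is the direct sum of its restrictions to E₁ and E₂ exactly when every V has a
-- subspace X ≤ A₁ + A₂ with Aᵢ ≤ Eᵢ and ρ(A₁) + ρ(A₂) + dim V ≤ ρ(V) + dim X (`Splits`).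
-- Given cyclic flats Z₁, Z₂ as in (ii), such an X is V ∩ Z, where Z is the closure of a
-- minimal subspace of V of the same nullity; Z is a cyclic flat, hence a sum Y₁ + Y₂.
-- A loop, or a hyperplane of smaller rank, splits M in the same sense, so an irreducible
-- M is full.  Conversely, for a cyclic flat Z the X that belongs to V = Z has to be all
-- of Z, since a hyperplane of Z above X would have smaller rank than Z; therefore
-- Z = A₁ + A₂, and the summands inherit flatness and cyclicity from Z and fullness.
module Submission where

open import Defs
open import Algebra.Bundles using (CommutativeMonoid; CommutativeRing)
import Algebra.Properties.AbelianGroup as AbelianGroupProperties
import Algebra.Properties.CommutativeSemigroup as CommutativeSemigroupProperties
import Algebra.Properties.Ring as RingProperties
open import Data.Fin.Base using (Fin; zero; suc; combine; finToFun; funToFin)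
import Data.Fin.Properties as Fin
open import Data.Integer.Base as ℤ using (ℤ; +_)
import Data.Integer.Properties as ℤ
import Data.Integer.Tactic.RingSolver as ℤRing
open import Data.List.Base using ([]; _∷_)
open import Data.List.Membership.Propositional using (_∈_; find)
open import Data.List.Membership.Propositional.Properties using (∈-filter⁺; ∈-map⁺)
open import Data.List.Relation.Unary.All as All using (All; []; _∷_)
import Data.List.Relation.Unary.All.Properties as All
open import Data.List.Relation.Unary.Any using (here; there)
open import Data.Nat.Base as ℕ using (ℕ; zero; suc; _+_; _≤_; _<_; z≤n; s≤s; s≤s⁻¹)
import Data.Nat.Properties as ℕ
open import Data.Product.Base using (∃; ∃₂; _×_; _,_; proj₁; proj₂)
open import Data.Sum.Base using (_⊎_; inj₁; inj₂)
open import Data.Vec.Functional using (Vector; tail) renaming (_∷_ to _∷ᵛ_; [] to []ᵛ)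
open import Function.Base using (_∘_; case_of_)
open import Function.Bundles using (Inverse; Equivalence; _⇔_; mk⇔)
open import Level using (Level; Lift; lift; lower)
open import Relation.Binary.PropositionalEquality as ≡ using (_≡_)
import Relation.Binary.Reasoning.Setoid as SetoidReasoning
open import Relation.Nullary.Decidable.Core using (Dec; yes; no; map′; _×-dec_; ¬?; decidable-stable)
open import Relation.Nullary.Negation.Core using (¬_; contradiction)
open import Relation.Unary using (Pred; Decidable)

-- `Splits` allows arbitrary `A₁` and `A₂` where the direct sum formula has the two projections of
-- `X`. The projections are the least admissible pair, so nothing is lost, and cyclic flats can be
-- supplied as `A₁`, `A₂` directly. Nullity, dim - ρ, is the main bookkeeping device. To stay in ℕ
-- it is compared by cross-addition: `ρ Y + dim A ≤ ρ A + dim Y` says that the nullity of `A` is at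
-- most that of `Y`. Subspaces are predicates, so they cannot be listed, while cyclicity quantifies
-- over all of them. Existence therefore comes either from adjoining one vector at a time, with dim
-- E as the bound on the number of rounds, or from searching tuples of vectors and taking their
-- spans. The assumption dim E ≥ 2 is forced by fullness: a q-matroid on a line is irreducible, but
-- it has a loop or its zero hyperplane has smaller rank, so it is never full.

private
  variable
    c ℓ₁ ℓ₂ m ℓ p : Level

-- Size of a finite field.

module _ (F : FiniteField c ℓ₁ ℓ₂) where
  open FiniteField F hiding (_+_; zero)

  -- If the two were equal, every element would equal `1#`, so `1# - 0#` would be invertible and
  -- `1#` apart from `0#`, against irreflexivity.
  1≉0 : ¬ 1# ≈ 0#
  1≉0 1≈0 = #-irrefl 1≈0 (invertible⇒# (1# , inverse , inverse))
    where
    inverse : ∀ {x} → x ≈ 1#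
    inverse {x} = trans (trans (sym (*-identityˡ x)) (trans (*-congʳ 1≈0) (zeroˡ x))) (sym 1≈0)

  from-injective : ∀ {i j} → from i ≈ from j → i ≡ j
  from-injective eq = ≡.trans (≡.sym (inverseˡ refl)) (inverseˡ eq)
    where open Inverse finite using (inverseˡ)

  to-injective : ∀ {x y} → to x ≡ to y → x ≈ y
  to-injective eq = trans (sym (inverseʳ ≡.refl)) (inverseʳ eq)

  1<order : 1 < order
  1<order = distinct (to 1#) (to 0#) (1≉0 ∘ to-injective)
    where
    distinct : ∀ {n} (i j : Fin n) → ¬ i ≡ j → 1 < n
    distinct {suc zero}    zero zero i≢j = contradiction ≡.refl i≢j
    distinct {suc (suc n)} i    j    i≢j = s≤s (s≤s z≤n)

-- Linear combinations, Steinitz' lemma and search over tuples.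

module _ {F : FiniteField c ℓ₁ ℓ₂} (E : VectorSpace F m ℓ) where
  private module F = FiniteField F
  open VectorSpace E
  open AbelianGroupProperties +ᴹ-abelianGroup using (x∙y⁻¹≈ε⇒x≈y; x≈y⇒x∙y⁻¹≈ε)
  open CommutativeSemigroupProperties (CommutativeMonoid.commutativeSemigroup +ᴹ-commutativeMonoid)
    using (interchange)
  open SetoidReasoning ≈ᴹ-setoid

  private
    lc : ∀ {n} → Vector F.Carrier n → Vector Carrierᴹ n → Carrierᴹ
    lc = linearCombination vectors

  Independent : ∀ {n} → Vector Carrierᴹ n → Set _
  Independent b = ∀ a → lc a b ≈ᴹ 0ᴹ → ∀ i → a i F.≈ F.0#

  lc-cong : ∀ {n} {a a′ : Vector F.Carrier n} {b b′ : Vector Carrierᴹ n} →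
    (∀ i → a i F.≈ a′ i) → (∀ i → b i ≈ᴹ b′ i) → lc a b ≈ᴹ lc a′ b′
  lc-cong {zero}  a≈ b≈ = ≈ᴹ-refl
  lc-cong {suc n} a≈ b≈ = +ᴹ-cong (*ₗ-cong (a≈ zero) (b≈ zero)) (lc-cong (a≈ ∘ suc) (b≈ ∘ suc))

  lc-+ : ∀ {n} (a a′ : Vector F.Carrier n) b → lc a b +ᴹ lc a′ b ≈ᴹ lc (λ i → a i F.+ a′ i) b
  lc-+ {zero}  a a′ b = +ᴹ-identityˡ 0ᴹ
  lc-+ {suc n} a a′ b = ≈ᴹ-trans (interchange _ _ _ _)
    (+ᴹ-cong (≈ᴹ-sym (*ₗ-distribʳ _ _ _)) (lc-+ (tail a) (tail a′) (tail b)))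

  independent⇒injective : ∀ {n} {b : Vector Carrierᴹ n} → Independent b →
    ∀ a a′ → lc a b ≈ᴹ lc a′ b → ∀ i → a i F.≈ a′ i
  independent⇒injective {b = b} indep a a′ eq i = a≈a′
    where
    -- The difference is written with the factor `- 1#` so that `lc-+` and `lc-scale` apply.
    difference : lc (λ i → a i F.+ F.- F.1# F.* a′ i) b ≈ᴹ 0ᴹ
    difference = begin
      lc (λ i → a i F.+ F.- F.1# F.* a′ i) b        ≈⟨ lc-+ a _ b ⟨
      lc a b +ᴹ lc (λ i → F.- F.1# F.* a′ i) b      ≈⟨ +ᴹ-congˡ (lc-scale E (F.- F.1#) a′ b) ⟨
      lc a b +ᴹ (F.- F.1#) *ₗ lc a′ b               ≈⟨ +ᴹ-congˡ (-1*ₗ E _) ⟩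
      lc a b +ᴹ -ᴹ lc a′ b                          ≈⟨ x≈y⇒x∙y⁻¹≈ε eq ⟩
      0ᴹ                                            ∎
    open RingProperties (CommutativeRing.ring F.commutativeRing) using (-1*x≈-x)
    open AbelianGroupProperties (CommutativeRing.+-abelianGroup F.commutativeRing)
      using () renaming (x∙y⁻¹≈ε⇒x≈y to x-y≈0⇒x≈y)
    a≈a′ : a i F.≈ a′ i
    a≈a′ = x-y≈0⇒x≈y _ _
      (F.trans (F.+-congˡ (F.sym (-1*x≈-x (a′ i)))) (indep _ difference i))

  -- Steinitz' lemma by counting coefficient vectors: q ^ n ≤ q ^ k.
  independent≤spanning : ∀ {n k} {b : Vector Carrierᴹ n} {d : Vector Carrierᴹ k} →
    Independent b → (∀ a → Spanned {E = E} d (lc a b)) → n ≤ k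
  independent≤spanning {n} {k} {b} {d} indep spanned = ℕ.≮⇒≥ λ k<n →
    ℕ.<⇒≱ (ℕ.^-monoʳ-< F.order (1<order F) k<n) (Fin.injective⇒≤ {f = recode} recode-injective)
    where
    coefficients : Fin (F.order ℕ.^ n) → Vector F.Carrier n
    coefficients i = F.from ∘ finToFun i
    recode : Fin (F.order ℕ.^ n) → Fin (F.order ℕ.^ k)
    recode i = funToFin (F.to ∘ proj₁ (spanned (coefficients i)))
    funToFin-cong : ∀ {n o} {f g : Fin n → Fin o} → (∀ i → f i ≡ g i) → funToFin f ≡ funToFin g
    funToFin-cong {zero}  f≗g = ≡.refl
    funToFin-cong {suc n} f≗g = ≡.cong₂ combine (f≗g zero) (funToFin-cong (f≗g ∘ suc))
    finToFun-injective : ∀ {n o} (i j : Fin (o ℕ.^ n)) → (∀ t → finToFun {o} {n} i t ≡ finToFun j t) → i ≡ j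
    finToFun-injective {n} {o} i j eq = ≡.trans (≡.sym (Fin.funToFin-finToFin {n} {o} i))
      (≡.trans (funToFin-cong eq) (Fin.funToFin-finToFin {n} {o} j))
    recode-injective : ∀ {i j} → recode i ≡ recode j → i ≡ j
    recode-injective {i} {j} eq = finToFun-injective i j λ t → from-injective F
      (independent⇒injective indep _ _ (begin
        lc (coefficients i) b                          ≈⟨ proj₂ (spanned (coefficients i)) ⟩
        lc (proj₁ (spanned (coefficients i))) d
          ≈⟨ lc-cong (λ s → to-injective F (same s)) (λ _ → ≈ᴹ-refl) ⟩
        lc (proj₁ (spanned (coefficients j))) d        ≈⟨ proj₂ (spanned (coefficients j)) ⟨
        lc (coefficients j) b                          ∎) t)
      where
      same : ∀ s → F.to (proj₁ (spanned (coefficients i)) s) ≡ F.to (proj₁ (spanned (coefficients j)) s)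
      same s = ≡.trans (≡.sym (Fin.finToFun-funToFin _ s))
        (≡.trans (≡.cong (λ h → finToFun h s) eq) (Fin.finToFun-funToFin _ s))

  -- Stands in for a search over subspaces: every subspace is the span of a tuple, and tuples of a
  -- fixed length can be enumerated. `P` has to respect pointwise `≈ᴹ`, since the enumeration meets
  -- a tuple only up to that relation.
  any-vectors? : ∀ n {P : Pred (Vector Carrierᴹ n) p} →
    (∀ {b b′} → (∀ i → b i ≈ᴹ b′ i) → P b → P b′) → Decidable P → Dec (∃ P)
  any-vectors? zero    resp P? = map′ (λ pb → []ᵛ , pb) (λ (b , pb) → resp (λ ()) pb) (P? []ᵛ)
  any-vectors? (suc n) resp P? = map′
    (λ (x , b , pb) → x ∷ᵛ b , pb)
    (λ (b , pb) → b zero , tail b , resp (λ { zero → ≈ᴹ-refl ; (suc i) → ≈ᴹ-refl }) pb)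
    (any-element? E
      (λ x≈y (b , pb) → b , resp (λ { zero → x≈y ; (suc i) → ≈ᴹ-refl }) pb)
      (λ x → any-vectors? n
        (λ b≈ → resp (λ { zero → ≈ᴹ-refl ; (suc i) → b≈ i }))
        (λ b → P? (x ∷ᵛ b))))

-- The lattice of subspaces, exchange and dimension.

module _ {F : FiniteField c ℓ₁ ℓ₂} {E : VectorSpace F m ℓ} where
  private module F = FiniteField F
  open VectorSpace E
  open Subspace

  private
    lc : ∀ {n} → Vector F.Carrier n → Vector Carrierᴹ n → Carrierᴹ
    lc = linearCombination vectors

  difference-closed : ∀ (V : Subspace E) {x y} → x ∈ₛ V → y ∈ₛ V → x +ᴹ -ᴹ y ∈ₛ V
  difference-closed V x∈ y∈ = +ᴹ-closed V x∈ (-ᴹ-closed V y∈)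

  move-right : ∀ {x y z} → x ≈ᴹ y +ᴹ z → y ≈ᴹ x +ᴹ -ᴹ z
  move-right {x} {y} {z} x≈y+z = begin
    y                     ≈⟨ +ᴹ-identityʳ y ⟨
    y +ᴹ 0ᴹ               ≈⟨ +ᴹ-congˡ (-ᴹ‿inverseʳ z) ⟨
    y +ᴹ (z +ᴹ -ᴹ z)      ≈⟨ +ᴹ-assoc y z _ ⟨
    (y +ᴹ z) +ᴹ -ᴹ z      ≈⟨ +ᴹ-congʳ x≈y+z ⟨
    x +ᴹ -ᴹ z             ∎
    where open SetoidReasoning ≈ᴹ-setoid

  move-left : ∀ {x y z} → x ≈ᴹ y +ᴹ z → z ≈ᴹ x +ᴹ -ᴹ y
  move-left x≈y+z = move-right (≈ᴹ-trans x≈y+z (+ᴹ-comm _ _))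

  ⊥ₛ-least : ∀ (V : Subspace E) → ⊥ₛ ≤ₛ V
  ⊥ₛ-least V (lift x≈0) = mem-resp V (≈ᴹ-sym x≈0) (0ᴹ-closed V)

  ≤-+ˡ : ∀ (V W : Subspace E) → V ≤ₛ V +ₛ W
  ≤-+ˡ V W {x} x∈ = x , 0ᴹ , x∈ , 0ᴹ-closed W , ≈ᴹ-sym (+ᴹ-identityʳ x)

  ≤-+ʳ : ∀ (V W : Subspace E) → W ≤ₛ V +ₛ W
  ≤-+ʳ V W {x} x∈ = 0ᴹ , x , 0ᴹ-closed V , x∈ , ≈ᴹ-sym (+ᴹ-identityˡ x)

  +-least : ∀ (V W U : Subspace E) → V ≤ₛ U → W ≤ₛ U → V +ₛ W ≤ₛ U
  +-least V W U V≤U W≤U (v , w , v∈ , w∈ , x≈) =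
    mem-resp U (≈ᴹ-sym x≈) (+ᴹ-closed U (V≤U v∈) (W≤U w∈))

  +-mono : ∀ (V V′ W W′ : Subspace E) → V ≤ₛ V′ → W ≤ₛ W′ → V +ₛ W ≤ₛ V′ +ₛ W′
  +-mono V V′ W W′ V≤V′ W≤W′ (v , w , v∈ , w∈ , x≈) = v , w , V≤V′ v∈ , W≤W′ w∈ , x≈

  +-swap : ∀ (V W : Subspace E) → V +ₛ W ≤ₛ W +ₛ V
  +-swap V W = +-least V W (W +ₛ V) (≤-+ʳ W V) (≤-+ˡ W V)

  ∈⟨⟩ : ∀ x → x ∈ₛ ⟨_⟩ {E = E} x
  ∈⟨⟩ x = lift (F.1# , ≈ᴹ-sym (*ₗ-identityˡ x))

  ⟨⟩-least : ∀ (V : Subspace E) {x} → x ∈ₛ V → ⟨ x ⟩ ≤ₛ V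
  ⟨⟩-least V x∈ (lift (s , y≈sx)) = mem-resp V (≈ᴹ-sym y≈sx) (*ₗ-closed V s x∈)

  ∈-+⟨⟩ : ∀ (V : Subspace E) x → x ∈ₛ V +ₛ ⟨ x ⟩
  ∈-+⟨⟩ V x = ≤-+ʳ V ⟨ x ⟩ (∈⟨⟩ x)

  +⟨⟩-least : ∀ (V U : Subspace E) {x} → V ≤ₛ U → x ∈ₛ U → V +ₛ ⟨ x ⟩ ≤ₛ U
  +⟨⟩-least V U {x} V≤U x∈U = +-least V ⟨ x ⟩ U V≤U (⟨⟩-least U x∈U)

  -- In `y ≈ v + s x` the scalar `s` is nonzero, as otherwise `y` would lie in `V`; dividing by it
  -- expresses `x` through `y` and `v`.
  exchange : ∀ (V : Subspace E) {x y} → y ∈ₛ V +ₛ ⟨ x ⟩ → ¬ y ∈ₛ V → x ∈ₛ V +ₛ ⟨ y ⟩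
  exchange V {x} {y} (v , w , v∈ , lift (s , w≈sx) , y≈v+w) y∉V with F.zero-or-invertible s
  ... | inj₁ s≈0 = contradiction
          (mem-resp V (≈ᴹ-sym (≈ᴹ-trans y≈v+w (≈ᴹ-trans (+ᴹ-congˡ w≈0) (+ᴹ-identityʳ v)))) v∈) y∉V
    where
    w≈0 : w ≈ᴹ 0ᴹ
    w≈0 = ≈ᴹ-trans w≈sx (≈ᴹ-trans (*ₗ-congʳ s≈0) (*ₗ-zeroˡ x))
  ... | inj₂ (u , us≈1) = mem-resp V+⟨y⟩ (≈ᴹ-sym x≈)
          (*ₗ-closed V+⟨y⟩ u (difference-closed V+⟨y⟩ (∈-+⟨⟩ V y) (≤-+ˡ V ⟨ y ⟩ v∈)))
    where
    open SetoidReasoning ≈ᴹ-setoid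
    V+⟨y⟩ : Subspace E
    V+⟨y⟩ = V +ₛ ⟨ y ⟩
    x≈ : x ≈ᴹ u *ₗ (y +ᴹ -ᴹ v)
    x≈ = begin
      x                      ≈⟨ *ₗ-identityˡ x ⟨
      F.1# *ₗ x              ≈⟨ *ₗ-congʳ us≈1 ⟨
      (u F.* s) *ₗ x         ≈⟨ *ₗ-assoc u s x ⟩
      u *ₗ s *ₗ x            ≈⟨ *ₗ-congˡ w≈sx ⟨
      u *ₗ w                 ≈⟨ *ₗ-congˡ (move-left y≈v+w) ⟩
      u *ₗ (y +ᴹ -ᴹ v)       ∎

  -- A hyperplane meets a space it does not contain in a hyperplane of that space. Exchange replaces
  -- `x` by `y`, and because `y` lies in `Y`, the modular law lets the intersection with `Y` pass
  -- inside the sum.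
  hyperplane-slice : ∀ (V W Y : Subspace E) {x y} → V ≤ₛ W +ₛ ⟨ x ⟩ → Y ≤ₛ V →
    y ∈ₛ Y → ¬ y ∈ₛ W → Y ≤ₛ (W ∩ₛ Y) +ₛ ⟨ y ⟩
  hyperplane-slice V W Y {x} {y} V≤ Y≤V y∈Y y∉W {z} z∈Y =
    let (w , v , w∈ , lift (s , v≈sy) , z≈w+v) = z∈W+⟨y⟩
    in w , v ,
       (w∈ , mem-resp Y (≈ᴹ-sym (move-right z≈w+v))
         (difference-closed Y z∈Y (⟨⟩-least Y y∈Y (lift (s , v≈sy))))) ,
       lift (s , v≈sy) , z≈w+v
    where
    z∈W+⟨y⟩ : z ∈ₛ W +ₛ ⟨ y ⟩
    z∈W+⟨y⟩ = +⟨⟩-least W (W +ₛ ⟨ y ⟩) (≤-+ˡ W ⟨ y ⟩)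
      (exchange W (V≤ (Y≤V y∈Y)) y∉W) (V≤ (Y≤V z∈Y))

  outside? : ∀ (V W : Subspace E) → Dec (∃ λ x → x ∈ₛ V × ¬ x ∈ₛ W)
  outside? V W = any-element? E
    (λ x≈y (x∈ , x∉) → mem-resp V x≈y x∈ , x∉ ∘ mem-resp W (≈ᴹ-sym x≈y))
    (λ x → mem? V x ×-dec ¬? (mem? W x))

  ≤-or-outside : ∀ (V W : Subspace E) → V ≤ₛ W ⊎ ∃ λ x → x ∈ₛ V × ¬ x ∈ₛ W
  ≤-or-outside V W with outside? V W
  ... | yes outside = inj₂ outside
  ... | no ¬outside = inj₁ λ {x} x∈ → decidable-stable (mem? W x) (λ x∉ → ¬outside (x , x∈ , x∉))

  _≤ₛ?_ : ∀ (V W : Subspace E) → Dec (V ≤ₛ W)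
  V ≤ₛ? W with ≤-or-outside V W
  ... | inj₁ V≤W            = yes V≤W
  ... | inj₂ (x , x∈ , x∉) = no λ V≤W → x∉ (V≤W x∈)

  lc-closed : ∀ (V : Subspace E) {n} (a : Vector F.Carrier n) {b} → (∀ i → b i ∈ₛ V) → lc a b ∈ₛ V
  lc-closed V {zero}  a b∈ = 0ᴹ-closed V
  lc-closed V {suc n} a b∈ = +ᴹ-closed V (*ₗ-closed V (a zero) (b∈ zero)) (lc-closed V (tail a) (b∈ ∘ suc))

  span : ∀ {n} → Vector Carrierᴹ n → Subspace E
  span b = record
    { mem       = λ x → Lift m (Spanned {E = E} b x)
    ; mem?      = λ x → map′ lift lower (span? E b x)
    ; mem-resp  = λ x≈y (lift (a , x≈)) → lift (a , ≈ᴹ-trans (≈ᴹ-sym x≈y) x≈)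
    ; 0ᴹ-closed = lift ((λ _ → F.0#) , ≈ᴹ-sym (lc-zero E _ b (λ _ → F.refl)))
    ; +ᴹ-closed = λ (lift (a , x≈)) (lift (a′ , y≈)) →
        lift (_ , ≈ᴹ-trans (+ᴹ-cong x≈ y≈) (lc-+ E a a′ b))
    ; *ₗ-closed = λ s (lift (a , x≈)) → lift (_ , ≈ᴹ-trans (*ₗ-congˡ x≈) (lc-scale E s a b))
    }

  span-cong : ∀ {n} (b b′ : Vector Carrierᴹ n) → (∀ i → b i ≈ᴹ b′ i) → span b ≤ₛ span b′
  span-cong b b′ b≈ (lift (a , x≈)) = lift (a , ≈ᴹ-trans x≈ (lc-cong E (λ _ → F.refl) b≈))

  span-least : ∀ (V : Subspace E) {n} {b : Vector Carrierᴹ n} → (∀ i → b i ∈ₛ V) → span b ≤ₛ V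
  span-least V b∈ (lift (a , x≈)) = mem-resp V (≈ᴹ-sym x≈) (lc-closed V a b∈)

  module Basis (V : Subspace E) where
    vectorsᵇ : Vector Carrierᴹ (dim V)
    vectorsᵇ = proj₁ (proj₂ (hasBasis V))
    open IsBasis (proj₂ (proj₂ (hasBasis V))) public

  -- `dim` is the length of one greedily found basis. This bound and `≤dim` tie it to arbitrary
  -- spanning and independent families, so the choice of that basis does not matter.
  dim≤ : ∀ (V : Subspace E) {k} (d : Vector Carrierᴹ k) → (∀ {x} → x ∈ₛ V → Spanned {E = E} d x) → dim V ≤ k
  dim≤ V d spanned = independent≤spanning E (Basis.independent V)
    (λ a → spanned (lc-closed V a (Basis.members V)))

  ≤dim : ∀ (V : Subspace E) {n} {b : Vector Carrierᴹ n} → Independent E b → (∀ i → b i ∈ₛ V) → n ≤ dim V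
  ≤dim V indep b∈ = independent≤spanning E indep (λ a → Basis.spanning V (lc-closed V a b∈))

  dim-mono : ∀ (V W : Subspace E) → V ≤ₛ W → dim V ≤ dim W
  dim-mono V W V≤W = dim≤ V (Basis.vectorsᵇ W) (λ x∈ → Basis.spanning W (V≤W x∈))

  dim-⊥ : dim {E = E} ⊥ₛ ≡ 0
  dim-⊥ = ℕ.n≤0⇒n≡0 (dim≤ ⊥ₛ []ᵛ (λ (lift x≈0) → []ᵛ , x≈0))

  dim-+⟨⟩≤ : ∀ (V : Subspace E) x → dim (V +ₛ ⟨ x ⟩) ≤ suc (dim V)
  dim-+⟨⟩≤ V x = dim≤ (V +ₛ ⟨ x ⟩) (x ∷ᵛ Basis.vectorsᵇ V) spanned
    where
    spanned : ∀ {y} → y ∈ₛ V +ₛ ⟨ x ⟩ → Spanned {E = E} (x ∷ᵛ Basis.vectorsᵇ V) y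
    spanned (v , w , v∈ , lift (s , w≈) , y≈) =
      let (a , v≈) = Basis.spanning V v∈
      in s ∷ᵛ a , ≈ᴹ-trans y≈ (≈ᴹ-trans (+ᴹ-comm v w) (+ᴹ-cong w≈ v≈))

  dim-+⟨⟩> : ∀ (V : Subspace E) {x} → ¬ x ∈ₛ V → suc (dim V) ≤ dim (V +ₛ ⟨ x ⟩)
  dim-+⟨⟩> V {x} x∉ = ≤dim (V +ₛ ⟨ x ⟩) {b = x ∷ᵛ Basis.vectorsᵇ V}
    (extend-independent E (Basis.vectorsᵇ V) x (Basis.independent V)
      (λ (a , x≈) → x∉ (mem-resp V (≈ᴹ-sym x≈) (lc-closed V a (Basis.members V)))))
    λ { zero → ∈-+⟨⟩ V x ; (suc i) → ≤-+ˡ V ⟨ x ⟩ (Basis.members V i) }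

  dim-⟨⟩ : ∀ x → dim {E = E} ⟨ x ⟩ ≤ 1
  dim-⟨⟩ x = ℕ.≤-trans (dim-mono ⟨ x ⟩ (⊥ₛ +ₛ ⟨ x ⟩) (≤-+ʳ ⊥ₛ ⟨ x ⟩))
    (ℕ.≤-trans (dim-+⟨⟩≤ ⊥ₛ x) (s≤s (ℕ.≤-reflexive dim-⊥)))

  -- `P` is an invariant and `Q U` describes the vectors still to be adjoined to `U`. Each of them
  -- lies outside `U`, so every round raises the dimension and the process stops.
  ascend : ∀ {q} {P : Pred (Subspace E) p} {Q : Subspace E → Pred Carrierᴹ q} →
    (∀ U → Dec (∃ (Q U))) → (∀ U {x} → Q U x → ¬ x ∈ₛ U) →
    (∀ U {x} → P U → Q U x → P (U +ₛ ⟨ x ⟩)) →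
    ∀ U → P U → ∃ λ V → P V × (∀ x → ¬ Q V x)
  ascend {P = P} {Q} Q? Q⇒∉ step U PU = go (dim {E = E} ⊤ₛ) U PU (ℕ.m≤m+n _ _)
    where
    go : ∀ fuel U → P U → dim {E = E} ⊤ₛ ≤ fuel + dim U → ∃ λ V → P V × (∀ x → ¬ Q V x)
    go fuel U PU enough with Q? U
    ... | no ¬QU = U , PU , λ x QUx → ¬QU (x , QUx)
    -- Without fuel `dim U` already reaches `dim ⊤ₛ`, and one more vector would exceed it.
    go zero U PU enough | yes (x , QUx) = contradiction (dim-mono (U +ₛ ⟨ x ⟩) ⊤ₛ _)
      (ℕ.<⇒≱ (ℕ.≤-trans (s≤s enough) (dim-+⟨⟩> U (Q⇒∉ U QUx))))
    go (suc fuel) U PU enough | yes (x , QUx) = go fuel (U +ₛ ⟨ x ⟩) (step U PU QUx)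
      (ℕ.≤-trans enough (ℕ.≤-trans (ℕ.≤-reflexive (≡.sym (ℕ.+-suc fuel (dim U))))
        (ℕ.+-monoʳ-≤ fuel (dim-+⟨⟩> U (Q⇒∉ U QUx)))))

  -- Induction from `A` up to `Y`, one new vector at a time. The result is some `U` with the same
  -- vectors as `Y`, because `P` is not assumed to respect equality of subspaces.
  climb : ∀ (P : Pred (Subspace E) p) (A Y : Subspace E) → A ≤ₛ Y → P A →
    (∀ U {x} → U ≤ₛ Y → x ∈ₛ Y → ¬ x ∈ₛ U → P U → P (U +ₛ ⟨ x ⟩)) →
    ∃ λ U → Y ≤ₛ U × U ≤ₛ Y × P U
  climb P A Y A≤Y PA step =
    let (U , (U≤Y , PU) , ¬outside) = ascend {P = λ U → U ≤ₛ Y × P U} (outside? Y) (λ _ → proj₂)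
          (λ U (U≤Y , PU) (x∈ , x∉) → +⟨⟩-least U Y U≤Y x∈ , step U U≤Y x∈ x∉ PU) A (A≤Y , PA)
    in U , (λ {x} x∈ → decidable-stable (mem? U x) (λ x∉ → ¬outside x (x∈ , x∉))) , U≤Y , PU

  -- Grow `X` inside `V` by vectors outside `U +ₛ ⟨ x ⟩`. By exchange such a vector never brings `x`
  -- into the space, and when none is left `x` alone completes it to `V`.
  hyperplane-above : ∀ (X V : Subspace E) {x} → X ≤ₛ V → x ∈ₛ V → ¬ x ∈ₛ X →
    ∃ λ H → X ≤ₛ H × H ≤ₛ V × ¬ x ∈ₛ H × V ≤ₛ H +ₛ ⟨ x ⟩
  hyperplane-above X V {x} X≤V x∈V x∉X =
    let (H , (X≤H , H≤V , x∉H) , ¬outside) = ascend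
          {P = λ U → X ≤ₛ U × U ≤ₛ V × ¬ x ∈ₛ U}
          (λ U → outside? V (U +ₛ ⟨ x ⟩))
          (λ U (_ , z∉) z∈ → z∉ (≤-+ˡ U ⟨ x ⟩ z∈))
          (λ U {z} (X≤U , U≤V , x∉U) (z∈V , z∉) →
            (λ y∈ → ≤-+ˡ U ⟨ z ⟩ (X≤U y∈)) , +⟨⟩-least U V U≤V z∈V ,
            λ x∈ → z∉ (exchange U x∈ x∉U))
          X ((λ y∈ → y∈) , X≤V , x∉X)
    in H , X≤H , H≤V , x∉H ,
       λ {z} z∈ → decidable-stable (mem? (H +ₛ ⟨ x ⟩) z) (λ z∉ → ¬outside z (z∈ , z∉))

  open ℕ.≤-Reasoning

  -- Each vector adjoined between `A` and `Y` raises `dim U` by one, but `dim (U +ₛ S)` by at most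
  -- one.
  dim-translate-≤ : ∀ (A Y S : Subspace E) → A ≤ₛ Y → dim (Y +ₛ S) + dim A ≤ dim (A +ₛ S) + dim Y
  dim-translate-≤ A Y S A≤Y =
    let (U , Y≤U , U≤Y , bound) = climb (λ U → dim (U +ₛ S) + dim A ≤ dim (A +ₛ S) + dim U) A Y A≤Y
          ℕ.≤-refl step
    in ℕ.≤-trans (ℕ.+-monoˡ-≤ (dim A) (dim-mono (Y +ₛ S) (U +ₛ S) (+-mono Y U S S Y≤U (λ x∈ → x∈))))
         (ℕ.≤-trans bound (ℕ.+-monoʳ-≤ (dim (A +ₛ S)) (dim-mono U Y U≤Y)))
    where
    step : ∀ U {x} → U ≤ₛ Y → x ∈ₛ Y → ¬ x ∈ₛ U →
      dim (U +ₛ S) + dim A ≤ dim (A +ₛ S) + dim U →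
      dim (U +ₛ ⟨ x ⟩ +ₛ S) + dim A ≤ dim (A +ₛ S) + dim (U +ₛ ⟨ x ⟩)
    step U {x} _ _ x∉ bound = begin
      dim (U +ₛ ⟨ x ⟩ +ₛ S) + dim A
        ≤⟨ ℕ.+-monoˡ-≤ (dim A) (dim-mono (U +ₛ ⟨ x ⟩ +ₛ S) (U +ₛ S +ₛ ⟨ x ⟩) reorder) ⟩
      dim (U +ₛ S +ₛ ⟨ x ⟩) + dim A          ≤⟨ ℕ.+-monoˡ-≤ (dim A) (dim-+⟨⟩≤ (U +ₛ S) x) ⟩
      suc (dim (U +ₛ S) + dim A)             ≤⟨ s≤s bound ⟩
      suc (dim (A +ₛ S) + dim U)             ≡⟨ ℕ.+-suc (dim (A +ₛ S)) (dim U) ⟨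
      dim (A +ₛ S) + suc (dim U)             ≤⟨ ℕ.+-monoʳ-≤ (dim (A +ₛ S)) (dim-+⟨⟩> U x∉) ⟩
      dim (A +ₛ S) + dim (U +ₛ ⟨ x ⟩)        ∎
      where
      reorder : U +ₛ ⟨ x ⟩ +ₛ S ≤ₛ U +ₛ S +ₛ ⟨ x ⟩
      reorder = +-least (U +ₛ ⟨ x ⟩) S (U +ₛ S +ₛ ⟨ x ⟩)
        (+-mono U (U +ₛ S) ⟨ x ⟩ ⟨ x ⟩ (≤-+ˡ U S) (λ y∈ → y∈))
        (λ y∈ → ≤-+ˡ (U +ₛ S) ⟨ x ⟩ (≤-+ʳ U S y∈))

  dim-+≤ : ∀ (V W : Subspace E) → dim (V +ₛ W) ≤ dim V + dim W
  dim-+≤ V W = begin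
    dim (V +ₛ W)                          ≡⟨ ℕ.+-identityʳ _ ⟨
    dim (V +ₛ W) + 0                      ≡⟨ ≡.cong (λ n → dim (V +ₛ W) + n) dim-⊥ ⟨
    dim (V +ₛ W) + dim {E = E} ⊥ₛ         ≤⟨ dim-translate-≤ ⊥ₛ V W (⊥ₛ-least V) ⟩
    dim (⊥ₛ +ₛ W) + dim V
      ≤⟨ ℕ.+-monoˡ-≤ (dim V) (dim-mono (⊥ₛ +ₛ W) W (+-least ⊥ₛ W W (⊥ₛ-least W) (λ y∈ → y∈))) ⟩
    dim W + dim V                         ≡⟨ ℕ.+-comm (dim W) (dim V) ⟩
    dim V + dim W                         ∎

  -- A vector of `V` outside `U` stays outside `U +ₛ W`, because its component in `W` would lie in
  -- `V` too and hence vanish.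
  dim-+-direct : ∀ (V W : Subspace E) → (∀ {x} → x ∈ₛ V → x ∈ₛ W → x ≈ᴹ 0ᴹ) →
    dim V + dim W ≤ dim (V +ₛ W)
  dim-+-direct V W disjoint =
    let (U , V≤U , U≤V , bound) = climb (λ U → dim U + dim W ≤ dim (U +ₛ W)) ⊥ₛ V (⊥ₛ-least V)
          (ℕ.≤-trans (ℕ.≤-reflexive (≡.cong (_+ dim W) dim-⊥)) (dim-mono W (⊥ₛ +ₛ W) (≤-+ʳ ⊥ₛ W))) step
    in ℕ.≤-trans (ℕ.+-monoˡ-≤ (dim W) (dim-mono V U V≤U))
         (ℕ.≤-trans bound (dim-mono (U +ₛ W) (V +ₛ W) (+-mono U V W W U≤V (λ x∈ → x∈))))
    where
    step : ∀ U {x} → U ≤ₛ V → x ∈ₛ V → ¬ x ∈ₛ U →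
      dim U + dim W ≤ dim (U +ₛ W) → dim (U +ₛ ⟨ x ⟩) + dim W ≤ dim (U +ₛ ⟨ x ⟩ +ₛ W)
    step U {x} U≤V x∈V x∉U bound = begin
      dim (U +ₛ ⟨ x ⟩) + dim W       ≤⟨ ℕ.+-monoˡ-≤ (dim W) (dim-+⟨⟩≤ U x) ⟩
      suc (dim U + dim W)            ≤⟨ s≤s bound ⟩
      suc (dim (U +ₛ W))             ≤⟨ dim-+⟨⟩> (U +ₛ W) x∉ ⟩
      dim (U +ₛ W +ₛ ⟨ x ⟩)          ≤⟨ dim-mono (U +ₛ W +ₛ ⟨ x ⟩) (U +ₛ ⟨ x ⟩ +ₛ W) reorder ⟩
      dim (U +ₛ ⟨ x ⟩ +ₛ W)          ∎
      where
      reorder : U +ₛ W +ₛ ⟨ x ⟩ ≤ₛ U +ₛ ⟨ x ⟩ +ₛ W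
      reorder = +⟨⟩-least (U +ₛ W) (U +ₛ ⟨ x ⟩ +ₛ W)
        (+-mono U (U +ₛ ⟨ x ⟩) W W (≤-+ˡ U ⟨ x ⟩) (λ y∈ → y∈))
        (≤-+ˡ (U +ₛ ⟨ x ⟩) W (∈-+⟨⟩ U x))
      x∉ : ¬ x ∈ₛ U +ₛ W
      x∉ (u , w , u∈ , w∈ , x≈) = x∉U (mem-resp U
        (≈ᴹ-sym (≈ᴹ-trans x≈ (≈ᴹ-trans (+ᴹ-congˡ w≈0) (+ᴹ-identityʳ u)))) u∈)
        where
        w≈0 : w ≈ᴹ 0ᴹ
        w≈0 = disjoint (mem-resp V (≈ᴹ-sym (move-left x≈)) (difference-closed V x∈V (U≤V u∈))) w∈

-- Nullity, flats and cyclic spaces of one q-matroid.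

module _ {F : FiniteField c ℓ₁ ℓ₂} {E : VectorSpace F m ℓ} (M : QMatroid E) where
  open VectorSpace E
  open QMatroid M
  open Subspace using (mem?; mem-resp; 0ᴹ-closed)
  open CommutativeSemigroupProperties ℕ.+-commutativeSemigroup using (xy∙z≈xz∙y)
  open ℕ.≤-Reasoning

  private
    ⟪_⟫ : ∀ {n} → Vector Carrierᴹ n → Subspace E
    ⟪_⟫ = span

  ρ-⊥ : ρ ⊥ₛ ≡ 0
  ρ-⊥ = ℕ.n≤0⇒n≡0 (ℕ.≤-trans (bounded ⊥ₛ) (ℕ.≤-reflexive (dim-⊥ {E = E})))

  ρ-+≤ : ∀ V W → ρ (V +ₛ W) ≤ ρ V + ρ W
  ρ-+≤ V W = ℕ.≤-trans (ℕ.m≤m+n _ _) (submodular V W)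

  ρ-+⟨⟩≤ : ∀ V x → ρ (V +ₛ ⟨ x ⟩) ≤ suc (ρ V)
  ρ-+⟨⟩≤ V x = begin
    ρ (V +ₛ ⟨ x ⟩)   ≤⟨ ρ-+≤ V ⟨ x ⟩ ⟩
    ρ V + ρ ⟨ x ⟩    ≤⟨ ℕ.+-monoʳ-≤ (ρ V) (ℕ.≤-trans (bounded ⟨ x ⟩) (dim-⟨⟩ {E = E} x)) ⟩
    ρ V + 1          ≡⟨ ℕ.+-comm (ρ V) 1 ⟩
    suc (ρ V)        ∎

  -- A new vector raises the dimension by one and the rank by at most one, so the nullity never
  -- falls.
  nullity-mono : ∀ A Y → A ≤ₛ Y → ρ Y + dim A ≤ ρ A + dim Y
  nullity-mono A Y A≤Y =
    let (U , Y≤U , U≤Y , bound) = climb (λ U → ρ U + dim A ≤ ρ A + dim U) A Y A≤Y ℕ.≤-refl step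
    in ℕ.≤-trans (ℕ.+-monoˡ-≤ (dim A) (monotone Y≤U))
         (ℕ.≤-trans bound (ℕ.+-monoʳ-≤ (ρ A) (dim-mono U Y U≤Y)))
    where
    step : ∀ U {x} → U ≤ₛ Y → x ∈ₛ Y → ¬ x ∈ₛ U →
      ρ U + dim A ≤ ρ A + dim U → ρ (U +ₛ ⟨ x ⟩) + dim A ≤ ρ A + dim (U +ₛ ⟨ x ⟩)
    step U {x} _ _ x∉ bound = begin
      ρ (U +ₛ ⟨ x ⟩) + dim A     ≤⟨ ℕ.+-monoˡ-≤ (dim A) (ρ-+⟨⟩≤ U x) ⟩
      suc (ρ U + dim A)          ≤⟨ s≤s bound ⟩
      suc (ρ A + dim U)          ≡⟨ ℕ.+-suc (ρ A) (dim U) ⟨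
      ρ A + suc (dim U)          ≤⟨ ℕ.+-monoʳ-≤ (ρ A) (dim-+⟨⟩> U x∉) ⟩
      ρ A + dim (U +ₛ ⟨ x ⟩)     ∎

  -- Diminishing returns: `S` adds to the larger space no more than to the smaller one. This is
  -- submodularity for `Y` and `A +ₛ S`, whose intersection contains `A`.
  submodular-translate : ∀ A Y S → A ≤ₛ Y → ρ (Y +ₛ S) + ρ A ≤ ρ Y + ρ (A +ₛ S)
  submodular-translate A Y S A≤Y = begin
    ρ (Y +ₛ S) + ρ A
      ≤⟨ ℕ.+-mono-≤ (monotone (+-mono Y Y S (A +ₛ S) (λ y∈ → y∈) (≤-+ʳ A S)))
           (monotone λ y∈ → A≤Y y∈ , ≤-+ˡ A S y∈) ⟩
    ρ (Y +ₛ (A +ₛ S)) + ρ (Y ∩ₛ (A +ₛ S))      ≤⟨ submodular Y (A +ₛ S) ⟩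
    ρ Y + ρ (A +ₛ S)                           ∎

  flat-below : ∀ A Y → IsFlat Y → A ≤ₛ Y → ∀ {x} → ¬ x ∈ₛ Y → ρ A < ρ (A +ₛ ⟨ x ⟩)
  flat-below A Y flat A≤Y {x} x∉ = ℕ.+-cancelˡ-≤ (ρ Y) _ _ (begin
    ρ Y + suc (ρ A)               ≡⟨ ℕ.+-suc (ρ Y) (ρ A) ⟩
    suc (ρ Y) + ρ A               ≤⟨ ℕ.+-monoˡ-≤ (ρ A) (flat x∉) ⟩
    ρ (Y +ₛ ⟨ x ⟩) + ρ A          ≤⟨ submodular-translate A Y ⟨ x ⟩ A≤Y ⟩
    ρ Y + ρ (A +ₛ ⟨ x ⟩)          ∎)

  flat-maximal : ∀ Z U → IsFlat Z → Z ≤ₛ U → ρ U ≤ ρ Z → U ≤ₛ Z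
  flat-maximal Z U flat Z≤U ρU≤ρZ {x} x∈U = decidable-stable (mem? Z x) λ x∉Z →
    ℕ.<⇒≱ (flat x∉Z) (ℕ.≤-trans (monotone (+⟨⟩-least Z U Z≤U x∈U)) ρU≤ρZ)

  cyclic-rank : ∀ V W {x} → IsCyclic V → x ∈ₛ V → W ≤ₛ V → V ≤ₛ W +ₛ ⟨ x ⟩ → ρ V ≤ ρ W
  cyclic-rank V W (_ , V⊆cyc) x∈ W≤V V≤ =
    ℕ.≤-reflexive (≡.sym (proj₂ (V⊆cyc x∈) W W≤V (+⟨⟩-least W V W≤V x∈ , V≤)))

  -- If `x` lies in `W`, then `W` is all of `V`. So cyclic means that no hyperplane has smaller
  -- rank, which is the form used from here on.
  cyclic-intro : ∀ V →
    (∀ W {x} → W ≤ₛ V → x ∈ₛ V → ¬ x ∈ₛ W → V ≤ₛ W +ₛ ⟨ x ⟩ → ρ V ≤ ρ W) → IsCyclic V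
  cyclic-intro V hyperplanes = proj₁ , λ {x} x∈ → x∈ , λ W W≤V (_ , V≤) →
    ℕ.≤-antisym (monotone W≤V) (case mem? W x of λ where
      (yes x∈W) → monotone λ y∈ → +⟨⟩-least W W (λ z∈ → z∈) x∈W (V≤ y∈)
      (no x∉W)  → hyperplanes W W≤V x∈ x∉W V≤)

  -- If `Y` is not inside `W`, then `W ∩ₛ Y` is a hyperplane of `Y` and has the rank of `Y`;
  -- submodularity then leaves no room for `Y` to add rank to `W`.
  cyclic-absorbed : ∀ V W Y {x} → V ≤ₛ W +ₛ ⟨ x ⟩ → IsCyclic Y → Y ≤ₛ V → ρ (W +ₛ Y) ≤ ρ W
  cyclic-absorbed V W Y {x} V≤ cyclic Y≤V with ≤-or-outside Y W
  ... | inj₁ Y≤W = monotone (+-least W Y W (λ y∈ → y∈) Y≤W)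
  ... | inj₂ (y , y∈Y , y∉W) = ℕ.+-cancelʳ-≤ (ρ Y) _ _ (begin
    ρ (W +ₛ Y) + ρ Y             ≤⟨ ℕ.+-monoʳ-≤ _ (cyclic-rank Y (W ∩ₛ Y) cyclic y∈Y proj₂
                                      (hyperplane-slice V W Y V≤ Y≤V y∈Y y∉W)) ⟩
    ρ (W +ₛ Y) + ρ (W ∩ₛ Y)      ≤⟨ submodular W Y ⟩
    ρ W + ρ Y                    ∎)

  -- A hyperplane `W` of the sum either misses a vector of `Y₁`, and then `W +ₛ Y₁` is everything,
  -- or contains `Y₁`, and then `W +ₛ Y₂` is. The summand added to `W` is absorbed in both cases.
  +-cyclic : ∀ Y₁ Y₂ → IsCyclic Y₁ → IsCyclic Y₂ → IsCyclic (Y₁ +ₛ Y₂)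
  +-cyclic Y₁ Y₂ cyclic₁ cyclic₂ = cyclic-intro V λ W W≤V x∈V _ V≤ →
    case ≤-or-outside Y₁ W of λ where
      (inj₂ (y , y∈Y₁ , y∉W)) → ℕ.≤-trans
        (monotone λ z∈ → +⟨⟩-least W (W +ₛ Y₁) (≤-+ˡ W Y₁)
          (+⟨⟩-least W (W +ₛ Y₁) (≤-+ˡ W Y₁) (≤-+ʳ W Y₁ y∈Y₁)
            (exchange W (V≤ (≤-+ˡ Y₁ Y₂ y∈Y₁)) y∉W))
          (V≤ z∈))
        (cyclic-absorbed V W Y₁ V≤ cyclic₁ (≤-+ˡ Y₁ Y₂))
      (inj₁ Y₁≤W) → ℕ.≤-trans
        (monotone (+-mono Y₁ W Y₂ Y₂ Y₁≤W (λ y∈ → y∈)))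
        (cyclic-absorbed V W Y₂ V≤ cyclic₂ (≤-+ʳ Y₁ Y₂))
    where
    V : Subspace E
    V = Y₁ +ₛ Y₂

  -- A hyperplane of `Z` absorbs `W`, so its rank is at least `ρ W`, which is already the rank of
  -- `Z`. Applies to closures and to equal subspaces.
  cyclic-same-rank : ∀ W Z → W ≤ₛ Z → ρ Z ≤ ρ W → IsCyclic W → IsCyclic Z
  cyclic-same-rank W Z W≤Z ρZ≤ρW cyclic = cyclic-intro Z λ H _ _ _ Z≤ →
    ℕ.≤-trans ρZ≤ρW (ℕ.≤-trans (monotone (≤-+ʳ H W)) (cyclic-absorbed Z H W Z≤ cyclic W≤Z))

  -- Pass to proper subspaces of no smaller nullity as long as there are any. A space without one is
  -- cyclic: a hyperplane of smaller rank loses one dimension and at least one unit of rank, so its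
  -- nullity is no smaller.
  cyclic-within : ∀ V → ∃ λ W → W ≤ₛ V × IsCyclic W × ρ W + dim V ≤ ρ V + dim W
  cyclic-within V = go (dim V) V ℕ.≤-refl
    where
    Drops : ∀ (V : Subspace E) {n} → Vector Carrierᴹ n → Set _
    Drops V b = ⟪ b ⟫ ≤ₛ V × ρ ⟪ b ⟫ + dim V ≤ ρ V + dim ⟪ b ⟫ × dim ⟪ b ⟫ < dim V

    -- `ℕ.pred (dim V)` is the length of a basis of a hyperplane. For `dim V` zero the tuple is
    -- empty, and the strict drop of dimension in `Drops` excludes a hit.
    drops? : ∀ (V : Subspace E) → Dec (∃ λ (b : Vector Carrierᴹ (ℕ.pred (dim V))) → Drops V b)
    drops? V = any-vectors? E _
      (λ {b} {b′} b≈ (b≤V , rank , drop) →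
        let ≤′ : ⟪ b ⟫ ≤ₛ ⟪ b′ ⟫
            ≤′ = span-cong {E = E} b b′ b≈
            ≥′ : ⟪ b′ ⟫ ≤ₛ ⟪ b ⟫
            ≥′ = span-cong {E = E} b′ b (λ i → ≈ᴹ-sym (b≈ i))
        in (λ x∈ → b≤V (≥′ x∈)) ,
           ℕ.≤-trans (ℕ.+-monoˡ-≤ _ (monotone ≥′))
             (ℕ.≤-trans rank (ℕ.+-monoʳ-≤ _ (dim-mono ⟪ b ⟫ ⟪ b′ ⟫ ≤′))) ,
           ℕ.≤-trans (s≤s (dim-mono ⟪ b′ ⟫ ⟪ b ⟫ ≥′)) drop)
      (λ b → (⟪ b ⟫ ≤ₛ? V) ×-dec (ρ ⟪ b ⟫ + dim V ℕ.≤? ρ V + dim ⟪ b ⟫) ×-dec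
        (dim ⟪ b ⟫ ℕ.<? dim V))

    basis-of-length : ∀ (U : Subspace E) {k} → k ≡ dim U →
      ∃ λ (b : Vector Carrierᴹ k) → ⟪ b ⟫ ≤ₛ U × U ≤ₛ ⟪ b ⟫
    basis-of-length U ≡.refl = Basis.vectorsᵇ U , span-least U (Basis.members U) ,
      λ x∈ → lift (Basis.spanning U x∈)

    cyclic : ∀ (V : Subspace E) → ¬ ∃ (Drops V) → IsCyclic V
    cyclic V ¬drops = cyclic-intro V λ W {x} W≤V x∈V x∉W V≤ → ℕ.≮⇒≥ λ ρW<ρV →
      let dimV≤ = ℕ.≤-trans (dim-mono V (W +ₛ ⟨ x ⟩) V≤) (dim-+⟨⟩≤ W x)
          dimW< = ℕ.≤-trans (dim-+⟨⟩> W x∉W) (dim-mono (W +ₛ ⟨ x ⟩) V (+⟨⟩-least W V W≤V x∈V))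
          (b , b≤W , W≤b) = basis-of-length W (≡.cong ℕ.pred (ℕ.≤-antisym dimV≤ dimW<))
      in ¬drops (b , (λ y∈ → W≤V (b≤W y∈)) ,
           (begin
             ρ ⟪ b ⟫ + dim V           ≤⟨ ℕ.+-mono-≤ (monotone b≤W) dimV≤ ⟩
             ρ W + suc (dim W)            ≡⟨ ℕ.+-suc (ρ W) (dim W) ⟩
             suc (ρ W) + dim W            ≤⟨ ℕ.+-mono-≤ ρW<ρV (dim-mono W ⟪ b ⟫ W≤b) ⟩
             ρ V + dim ⟪ b ⟫             ∎) ,
           ℕ.≤-trans (s≤s (dim-mono ⟪ b ⟫ W b≤W)) dimW<)

    go : ∀ fuel V → dim V ≤ fuel → ∃ λ W → W ≤ₛ V × IsCyclic W × ρ W + dim V ≤ ρ V + dim W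
    go fuel V enough with drops? V
    go fuel V enough | no ¬drops = V , (λ x∈ → x∈) , cyclic V ¬drops , ℕ.≤-refl
    go zero V enough | yes (b , _ , _ , drop) = contradiction (ℕ.≤-trans drop enough) λ ()
    go (suc fuel) V enough | yes (b , b≤V , rank , drop) =
      let (W , W≤b , cyclicW , rankW) = go fuel ⟪ b ⟫ (s≤s⁻¹ (ℕ.≤-trans drop enough))
      in W , (λ x∈ → b≤V (W≤b x∈)) , cyclicW , ℕ.+-cancelʳ-≤ (dim ⟪ b ⟫) _ _ (begin
           ρ W + dim V + dim ⟪ b ⟫          ≡⟨ xy∙z≈xz∙y (ρ W) _ _ ⟩
           ρ W + dim ⟪ b ⟫ + dim V          ≤⟨ ℕ.+-monoˡ-≤ (dim V) rankW ⟩
           ρ ⟪ b ⟫ + dim W + dim V        ≡⟨ xy∙z≈xz∙y (ρ ⟪ b ⟫) _ _ ⟩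
           ρ ⟪ b ⟫ + dim V + dim W        ≤⟨ ℕ.+-monoˡ-≤ (dim W) rank ⟩
           ρ V + dim ⟪ b ⟫ + dim W          ≡⟨ xy∙z≈xz∙y (ρ V) _ _ ⟩
           ρ V + dim W + dim ⟪ b ⟫          ∎)

  -- Vectors that leave the rank unchanged are adjoined until none remains; this stopping condition
  -- is flatness.
  flat-closure : ∀ W → ∃ λ Z → W ≤ₛ Z × ρ Z ≤ ρ W × IsFlat Z
  flat-closure W =
    let (Z , (W≤Z , ρZ≤ρW) , maximal) = ascend
          {P = λ U → W ≤ₛ U × ρ U ≤ ρ W} {Q = λ U x → ¬ x ∈ₛ U × ρ (U +ₛ ⟨ x ⟩) ≤ ρ U}
          (λ U → any-element? E
            (λ {x} {y} x≈y (x∉ , rank) → (λ y∈ → x∉ (mem-resp U (≈ᴹ-sym x≈y) y∈)) ,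
              ℕ.≤-trans (monotone (+⟨⟩-least U (U +ₛ ⟨ x ⟩) (≤-+ˡ U ⟨ x ⟩)
                (mem-resp (U +ₛ ⟨ x ⟩) x≈y (∈-+⟨⟩ U x)))) rank)
            (λ x → ¬? (mem? U x) ×-dec (ρ (U +ₛ ⟨ x ⟩) ℕ.≤? ρ U)))
          (λ _ → proj₁)
          (λ U {x} (W≤U , ρU≤ρW) (_ , rank) →
            (λ y∈ → ≤-+ˡ U ⟨ x ⟩ (W≤U y∈)) , ℕ.≤-trans rank ρU≤ρW)
          W ((λ x∈ → x∈) , ℕ.≤-refl)
    in Z , W≤Z , ρZ≤ρW , λ {x} x∉ → ℕ.≰⇒> λ rank → maximal x (x∉ , rank)

  -- Behind this is the formula for `ρ V` as the minimum of ρ(Z) + dim V - dim(V ∩ Z) over cyclic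
  -- flats Z, by which the cyclic flats and their ranks determine a q-matroid. The `Z` found attains
  -- the minimum, since `V ∩ₛ Z` contains the cyclic space whose closure it is.
  rank-via-cyclic-flat : ∀ V → ∃ λ Z → 𝒵 Z × ρ Z + dim V ≤ ρ V + dim (V ∩ₛ Z)
  rank-via-cyclic-flat V =
    let (W , W≤V , cyclicW , rankW) = cyclic-within V
        (Z , W≤Z , ρZ≤ρW , flatZ)   = flat-closure W
    in Z , ((λ {x} → flatZ {x}) , cyclic-same-rank W Z W≤Z ρZ≤ρW cyclicW) , (begin
         ρ Z + dim V             ≤⟨ ℕ.+-monoˡ-≤ (dim V) ρZ≤ρW ⟩
         ρ W + dim V             ≤⟨ rankW ⟩
         ρ V + dim W             ≤⟨ ℕ.+-monoʳ-≤ (ρ V) (dim-mono W (V ∩ₛ Z) λ x∈ → W≤V x∈ , W≤Z x∈) ⟩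
         ρ V + dim (V ∩ₛ Z)      ∎)

-- Ranks, flats and cyclic spaces along a splitting.

module _ {F : FiniteField c ℓ₁ ℓ₂} {E : VectorSpace F m ℓ} where
  open VectorSpace E
  open Subspace

  decomposition-swap : ∀ {E₁ E₂ : Subspace E} →
    IsDirectDecomposition E₁ E₂ → IsDirectDecomposition E₂ E₁
  decomposition-swap {E₁} {E₂} D = record
    { sum≈⊤          = _ , λ _ → +-swap E₁ E₂ (proj₂ D.sum≈⊤ _)
    ; intersection≈⊥ = (λ (x∈₂ , x∈₁) → proj₁ D.intersection≈⊥ (x∈₁ , x∈₂)) ,
                       ⊥ₛ-least (E₂ ∩ₛ E₁)
    }
    where module D = IsDirectDecomposition D

  -- The subspace lattice is not distributive; here the two ways of writing `x` agree because
  -- components along `E₁` and `E₂` are unique.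
  ∩-distributes : ∀ {E₁ E₂ : Subspace E} → IsDirectDecomposition E₁ E₂ →
    ∀ (A₁ A₂ B₁ B₂ X : Subspace E) → A₁ ≤ₛ E₁ → A₂ ≤ₛ E₂ → B₁ ≤ₛ E₁ → B₂ ≤ₛ E₂ →
    X ≤ₛ A₁ +ₛ A₂ → X ≤ₛ B₁ +ₛ B₂ → X ≤ₛ (A₁ ∩ₛ B₁) +ₛ (A₂ ∩ₛ B₂)
  ∩-distributes D A₁ A₂ B₁ B₂ X A₁≤ A₂≤ B₁≤ B₂≤ X≤A X≤B x∈ =
    let (a₁ , a₂ , a₁∈ , a₂∈ , x≈a) = X≤A x∈
        (b₁ , b₂ , b₁∈ , b₂∈ , x≈b) = X≤B x∈
        (b₁≈a₁ , b₂≈a₂) = IsDirectDecomposition.unique D (B₁≤ b₁∈) (A₁≤ a₁∈) (B₂≤ b₂∈) (A₂≤ a₂∈)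
          (≈ᴹ-trans (≈ᴹ-sym x≈b) x≈a)
    in a₁ , a₂ , (a₁∈ , mem-resp B₁ b₁≈a₁ b₁∈) , (a₂∈ , mem-resp B₂ b₂≈a₂ b₂∈) , x≈a

  direct-disjoint : ∀ {E₁ E₂ : Subspace E} → IsDirectDecomposition E₁ E₂ →
    ∀ {x} → x ∈ₛ E₁ → x ∈ₛ E₂ → x ≈ᴹ 0ᴹ
  direct-disjoint D x∈₁ x∈₂ = lower (proj₁ (IsDirectDecomposition.intersection≈⊥ D) (x∈₁ , x∈₂))

  -- M is the direct sum of its restrictions to E₁ and E₂, expressed through ρ alone:
  -- this is the attained half of the formula for the rank of a direct sum, the other
  -- half being a consequence of submodularity.
  Splits : QMatroid E → Subspace E → Subspace E → Set _
  Splits M E₁ E₂ = ∀ V → ∃ λ X → X ≤ₛ V × ∃₂ λ A₁ A₂ →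
    A₁ ≤ₛ E₁ × A₂ ≤ₛ E₂ × X ≤ₛ A₁ +ₛ A₂ × ρ A₁ + ρ A₂ + dim V ≤ ρ V + dim X
    where open QMatroid M

  splits-swap : ∀ (M : QMatroid E) {E₁ E₂} → Splits M E₁ E₂ → Splits M E₂ E₁
  splits-swap M splits V =
    let (X , X≤V , A₁ , A₂ , A₁≤ , A₂≤ , X≤ , rank) = splits V
    in X , X≤V , A₂ , A₁ , A₂≤ , A₁≤ , (λ x∈ → +-swap A₁ A₂ (X≤ x∈)) ,
       ≡.subst (λ r → r + dim V ≤ ρ V + dim X) (ℕ.+-comm (ρ A₁) (ρ A₂)) rank
    where open QMatroid M

  module _ (M : QMatroid E) {E₁ E₂ : Subspace E} (D : IsDirectDecomposition E₁ E₂)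
           (splits : Splits M E₁ E₂) where
    open QMatroid M
    open CommutativeSemigroupProperties ℕ.+-commutativeSemigroup using (interchange; xy∙z≈xz∙y; x∙yz≈xz∙y)
    open ℕ.≤-Reasoning

    -- The witness `X` for `Y₁ +ₛ Y₂` lies in `B₁ +ₛ B₂` by distributivity. Monotone nullity from
    -- each `Bᵢ` to `Yᵢ` converts the inequality for `X` into the one for the whole sum.
    ρ-additive : ∀ Y₁ Y₂ → Y₁ ≤ₛ E₁ → Y₂ ≤ₛ E₂ → ρ Y₁ + ρ Y₂ ≤ ρ (Y₁ +ₛ Y₂)
    ρ-additive Y₁ Y₂ Y₁≤ Y₂≤ =
      let (X , X≤V , A₁ , A₂ , A₁≤ , A₂≤ , X≤A , rank) = splits (Y₁ +ₛ Y₂)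
          B₁ = A₁ ∩ₛ Y₁
          B₂ = A₂ ∩ₛ Y₂
          dimX≤ : dim X ≤ dim B₁ + dim B₂
          dimX≤ = ℕ.≤-trans
            (dim-mono X (B₁ +ₛ B₂) (∩-distributes D A₁ A₂ Y₁ Y₂ X A₁≤ A₂≤ Y₁≤ Y₂≤ X≤A X≤V))
            (dim-+≤ B₁ B₂)
      in ℕ.+-cancelʳ-≤ (dim B₁ + dim B₂) _ _ (begin
        (ρ Y₁ + ρ Y₂) + (dim B₁ + dim B₂)      ≡⟨ interchange (ρ Y₁) _ _ _ ⟩
        (ρ Y₁ + dim B₁) + (ρ Y₂ + dim B₂)
          ≤⟨ ℕ.+-mono-≤ (nullity-mono M B₁ Y₁ proj₂) (nullity-mono M B₂ Y₂ proj₂) ⟩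
        (ρ B₁ + dim Y₁) + (ρ B₂ + dim Y₂)      ≡⟨ interchange (ρ B₁) _ _ _ ⟩
        (ρ B₁ + ρ B₂) + (dim Y₁ + dim Y₂)
          ≤⟨ ℕ.+-mono-≤ (ℕ.+-mono-≤ (monotone proj₁) (monotone proj₁))
               (dim-+-direct Y₁ Y₂ λ x∈₁ x∈₂ → direct-disjoint D (Y₁≤ x∈₁) (Y₂≤ x∈₂)) ⟩
        (ρ A₁ + ρ A₂) + dim (Y₁ +ₛ Y₂)         ≤⟨ rank ⟩
        ρ (Y₁ +ₛ Y₂) + dim X                   ≤⟨ ℕ.+-monoʳ-≤ _ dimX≤ ⟩
        ρ (Y₁ +ₛ Y₂) + (dim B₁ + dim B₂)       ∎)

    -- The rank of `V` is known only through its witness, so the strict increase is proved in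
    -- `bound` for every candidate `X`, `A₁`, `A₂`.
    +-flat : ∀ Y₁ Y₂ → Y₁ ≤ₛ E₁ → Y₂ ≤ₛ E₂ → IsFlat Y₁ → IsFlat Y₂ → IsFlat (Y₁ +ₛ Y₂)
    +-flat Y₁ Y₂ Y₁≤ Y₂≤ flat₁ flat₂ {x} x∉ =
      let (X , X≤V , A₁ , A₂ , A₁≤ , A₂≤ , X≤A , rank) = splits V
      in ℕ.+-cancelʳ-≤ (dim X) _ _ (ℕ.≤-trans (bound X A₁ A₂ X≤V A₁≤ A₂≤ X≤A) rank)
      where
      Z V : Subspace E
      Z = Y₁ +ₛ Y₂
      V = Z +ₛ ⟨ x ⟩

      rank-jump : ∀ A Y → IsFlat Y → ∀ {a} → a ∈ₛ A → ¬ a ∈ₛ Y → ρ Y < ρ (A +ₛ Y)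
      rank-jump A Y flat a∈ a∉ = ℕ.≤-trans (flat a∉)
        (monotone (+⟨⟩-least Y (A +ₛ Y) (≤-+ʳ A Y) (≤-+ˡ A Y a∈)))

      ranks-jump : ∀ X A₁ A₂ → X ≤ₛ A₁ +ₛ A₂ → ∀ {y} → y ∈ₛ X → ¬ y ∈ₛ Z →
        suc (ρ Y₁ + ρ Y₂) ≤ ρ (A₁ +ₛ Y₁) + ρ (A₂ +ₛ Y₂)
      ranks-jump X A₁ A₂ X≤A y∈ y∉ with X≤A y∈
      ... | a₁ , a₂ , a₁∈ , a₂∈ , y≈ with mem? Y₁ a₁
      ... | no a₁∉ = ℕ.+-mono-≤ (rank-jump A₁ Y₁ flat₁ a₁∈ a₁∉) (monotone (≤-+ʳ A₂ Y₂))
      ... | yes a₁∈Y = ℕ.≤-trans (ℕ.≤-reflexive (≡.sym (ℕ.+-suc (ρ Y₁) (ρ Y₂))))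
        (ℕ.+-mono-≤ (monotone (≤-+ʳ A₁ Y₁))
          (rank-jump A₂ Y₂ flat₂ a₂∈ λ a₂∈Y → y∉ (a₁ , a₂ , a₁∈Y , a₂∈Y , y≈)))

      rank-join : ∀ A Y → ρ (A +ₛ Y) + dim (A ∩ₛ Y) ≤ ρ A + dim Y
      rank-join A Y = ℕ.+-cancelʳ-≤ (ρ (A ∩ₛ Y)) _ _ (begin
        ρ (A +ₛ Y) + dim (A ∩ₛ Y) + ρ (A ∩ₛ Y)      ≡⟨ xy∙z≈xz∙y (ρ (A +ₛ Y)) _ _ ⟩
        ρ (A +ₛ Y) + ρ (A ∩ₛ Y) + dim (A ∩ₛ Y)      ≤⟨ ℕ.+-monoˡ-≤ _ (submodular A Y) ⟩
        ρ A + ρ Y + dim (A ∩ₛ Y)                    ≡⟨ ℕ.+-assoc (ρ A) _ _ ⟩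
        ρ A + (ρ Y + dim (A ∩ₛ Y))                  ≤⟨ ℕ.+-monoʳ-≤ (ρ A) (nullity-mono M (A ∩ₛ Y) Y proj₂) ⟩
        ρ A + (ρ (A ∩ₛ Y) + dim Y)                  ≡⟨ x∙yz≈xz∙y (ρ A) _ _ ⟩
        ρ A + dim Y + ρ (A ∩ₛ Y)                    ∎)

      bound : ∀ X A₁ A₂ → X ≤ₛ V → A₁ ≤ₛ E₁ → A₂ ≤ₛ E₂ → X ≤ₛ A₁ +ₛ A₂ →
        suc (ρ Z) + dim X ≤ ρ A₁ + ρ A₂ + dim V
      bound X A₁ A₂ X≤V A₁≤ A₂≤ X≤A with ≤-or-outside X Z
      ... | inj₁ X≤Z = begin
        suc (ρ Z + dim X)             ≤⟨ s≤s (nullity-mono M X Z X≤Z) ⟩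
        suc (ρ X + dim Z)             ≡⟨ ℕ.+-suc (ρ X) (dim Z) ⟨
        ρ X + suc (dim Z)             ≤⟨ ℕ.+-mono-≤ (ℕ.≤-trans (monotone X≤A) (ρ-+≤ M A₁ A₂)) (dim-+⟨⟩> Z x∉) ⟩
        ρ A₁ + ρ A₂ + dim V           ∎
      -- Two units have to be paid for: the successor, by the rank jump at a component of `y`
      -- outside its flat, and the dimension of `X` beyond `Z`, by `dim V` exceeding `dim Z`.
      ... | inj₂ (y , y∈X , y∉Z) = begin
        suc (ρ Z) + dim X
          ≤⟨ ℕ.+-mono-≤ (s≤s (ρ-+≤ M Y₁ Y₂)) dimX≤ ⟩
        suc (ρ Y₁ + ρ Y₂) + suc (dim B₁ + dim B₂)
          ≤⟨ ℕ.+-monoˡ-≤ _ (ranks-jump X A₁ A₂ X≤A y∈X y∉Z) ⟩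
        ρ (A₁ +ₛ Y₁) + ρ (A₂ +ₛ Y₂) + suc (dim B₁ + dim B₂)
          ≡⟨ ℕ.+-suc _ (dim B₁ + dim B₂) ⟩
        suc (ρ (A₁ +ₛ Y₁) + ρ (A₂ +ₛ Y₂) + (dim B₁ + dim B₂))
          ≡⟨ ≡.cong suc (interchange (ρ (A₁ +ₛ Y₁)) _ _ _) ⟩
        suc (ρ (A₁ +ₛ Y₁) + dim B₁ + (ρ (A₂ +ₛ Y₂) + dim B₂))
          ≤⟨ s≤s (ℕ.+-mono-≤ (rank-join A₁ Y₁) (rank-join A₂ Y₂)) ⟩
        suc (ρ A₁ + dim Y₁ + (ρ A₂ + dim Y₂))
          ≡⟨ ≡.cong suc (interchange (ρ A₁) _ _ _) ⟩
        suc (ρ A₁ + ρ A₂ + (dim Y₁ + dim Y₂))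
          ≤⟨ s≤s (ℕ.+-monoʳ-≤ _ (dim-+-direct Y₁ Y₂ λ x∈₁ x∈₂ →
               direct-disjoint D (Y₁≤ x∈₁) (Y₂≤ x∈₂))) ⟩
        suc (ρ A₁ + ρ A₂ + dim Z)
          ≡⟨ ℕ.+-suc _ (dim Z) ⟨
        ρ A₁ + ρ A₂ + suc (dim Z)
          ≤⟨ ℕ.+-monoʳ-≤ _ (dim-+⟨⟩> Z x∉) ⟩
        ρ A₁ + ρ A₂ + dim V ∎
        where
        B₁ B₂ : Subspace E
        B₁ = A₁ ∩ₛ Y₁
        B₂ = A₂ ∩ₛ Y₂
        dimX≤ : dim X ≤ suc (dim B₁ + dim B₂)
        dimX≤ = begin
          dim X
            ≤⟨ dim-mono X (Z ∩ₛ X +ₛ ⟨ y ⟩) (hyperplane-slice V Z X (λ z∈ → z∈) X≤V y∈X y∉Z) ⟩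
          dim (Z ∩ₛ X +ₛ ⟨ y ⟩)              ≤⟨ dim-+⟨⟩≤ (Z ∩ₛ X) y ⟩
          suc (dim (Z ∩ₛ X))                 ≤⟨ s≤s (dim-mono (Z ∩ₛ X) (B₁ +ₛ B₂)
                                                  (∩-distributes D A₁ A₂ Y₁ Y₂ (Z ∩ₛ X) A₁≤ A₂≤ Y₁≤ Y₂≤
                                                    (λ (_ , z∈X) → X≤A z∈X) proj₁)) ⟩
          suc (dim (B₁ +ₛ B₂))               ≤⟨ s≤s (dim-+≤ B₁ B₂) ⟩
          suc (dim B₁ + dim B₂)              ∎

    -- `A₁` is the intersection of the flats `Z` and `E₁`. A vector outside it misses one of the
    -- two, and what raises the rank of a flat raises that of any smaller space.
    component-flat : ∀ Z A₁ A₂ → IsFlat E₁ → IsFlat Z → A₁ ≤ₛ E₁ → A₂ ≤ₛ E₂ →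
      A₁ +ₛ A₂ ≤ₛ Z → Z ≤ₛ A₁ +ₛ A₂ → IsFlat A₁
    component-flat Z A₁ A₂ flatE₁ flatZ A₁≤ A₂≤ A≤Z Z≤A {x} x∉A₁ with mem? Z x
    ... | no x∉Z = flat-below M A₁ Z flatZ (λ y∈ → A≤Z (≤-+ˡ A₁ A₂ y∈)) x∉Z
    ... | yes x∈Z = flat-below M A₁ E₁ flatE₁ A₁≤ λ x∈E₁ →
      let (a₁ , a₂ , a₁∈ , a₂∈ , x≈) = Z≤A x∈Z
          a₂≈0 = direct-disjoint D
            (mem-resp E₁ (≈ᴹ-sym (move-left {E = E} x≈)) (difference-closed E₁ x∈E₁ (A₁≤ a₁∈))) (A₂≤ a₂∈)
      in x∉A₁ (mem-resp A₁ (≈ᴹ-sym (≈ᴹ-trans x≈ (≈ᴹ-trans (+ᴹ-congˡ a₂≈0) (+ᴹ-identityʳ a₁)))) a₁∈)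

  -- A hyperplane `W` of `A₁` extends to `W +ₛ A₂`, which together with `x` is `Z`. Since ranks add
  -- up on `Z`, a drop in `W` would be a drop in `Z`.
  component-cyclic : ∀ (M : QMatroid E) → let open QMatroid M in
    ∀ Z A₁ A₂ → IsCyclic Z → A₁ +ₛ A₂ ≤ₛ Z → Z ≤ₛ A₁ +ₛ A₂ → ρ A₁ + ρ A₂ ≤ ρ Z → IsCyclic A₁
  component-cyclic M Z A₁ A₂ cyclicZ A≤Z Z≤A rank = cyclic-intro M A₁ λ W {x} W≤ x∈ _ A₁≤ →
    ℕ.+-cancelʳ-≤ (ρ A₂) _ _ (begin
      ρ A₁ + ρ A₂      ≤⟨ rank ⟩
      ρ Z              ≤⟨ cyclic-rank M Z (W +ₛ A₂) cyclicZ (A≤Z (≤-+ˡ A₁ A₂ x∈))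
                            (λ y∈ → A≤Z (+-mono W A₁ A₂ A₂ W≤ (λ z∈ → z∈) y∈))
                            (λ y∈ → Z≤ W x A₁≤ (Z≤A y∈)) ⟩
      ρ (W +ₛ A₂)      ≤⟨ ρ-+≤ M W A₂ ⟩
      ρ W + ρ A₂       ∎)
    where
    open QMatroid M
    open ℕ.≤-Reasoning
    Z≤ : ∀ W x → A₁ ≤ₛ W +ₛ ⟨ x ⟩ → A₁ +ₛ A₂ ≤ₛ W +ₛ A₂ +ₛ ⟨ x ⟩
    Z≤ W x A₁≤ = +-least A₁ A₂ (W +ₛ A₂ +ₛ ⟨ x ⟩)
      (λ y∈ → +-mono W (W +ₛ A₂) ⟨ x ⟩ ⟨ x ⟩ (≤-+ˡ W A₂) (λ z∈ → z∈) (A₁≤ y∈))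
      (λ y∈ → ≤-+ˡ (W +ₛ A₂) ⟨ x ⟩ (≤-+ʳ W A₂ y∈))

-- Restriction of a q-matroid to a subspace.

module _ {F : FiniteField c ℓ₁ ℓ₂} {E : VectorSpace F m ℓ} (Z : Subspace E) where
  open VectorSpace E
  open Subspace
  private
    module E′ = VectorSpace (asSpace Z)
    module Z = Subspace Z

  embed : Subspace (asSpace Z) → Subspace E
  embed V = record
    { mem       = λ x → ∃ λ x∈Z → mem V (x , x∈Z)
    ; mem?      = λ x → member? x (mem? Z x)
    ; mem-resp  = λ x≈y (x∈Z , x∈V) → Z.mem-resp x≈y x∈Z , mem-resp V x≈y x∈V
    ; 0ᴹ-closed = Z.0ᴹ-closed , 0ᴹ-closed V
    ; +ᴹ-closed = λ (x∈Z , x∈V) (y∈Z , y∈V) → Z.+ᴹ-closed x∈Z y∈Z , +ᴹ-closed V x∈V y∈V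
    ; *ₗ-closed = λ s (x∈Z , x∈V) → Z.*ₗ-closed s x∈Z , *ₗ-closed V s x∈V
    }
    where
    member? : ∀ x → Dec (x ∈ₛ Z) → Dec (∃ λ x∈Z → mem V (x , x∈Z))
    member? x (no x∉Z)  = no (x∉Z ∘ proj₁)
    -- Membership may have been shown with another proof of `x ∈ₛ Z`; `asSpace Z` compares only the
    -- vectors, so `mem-resp` passes between them.
    member? x (yes x∈Z) = map′ (x∈Z ,_) (λ (_ , x∈V) → mem-resp V ≈ᴹ-refl x∈V) (mem? V (x , x∈Z))

  lc-embed : ∀ {n} (a : Vector (FiniteField.Carrier F) n) (b : Vector E′.Carrierᴹ n) →
    proj₁ (linearCombination E′.vectors a b) ≡ linearCombination vectors a (proj₁ ∘ b)
  lc-embed {zero}  a b = ≡.refl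
  lc-embed {suc n} a b = ≡.cong (a zero *ₗ proj₁ (b zero) +ᴹ_) (lc-embed (tail a) (tail b))

  dim-embed≤ : ∀ V → dim (embed V) ≤ dim V
  dim-embed≤ V = dim≤ (embed V) (proj₁ ∘ Basis.vectorsᵇ V) λ {x} (x∈Z , x∈V) →
    let (a , x≈) = Basis.spanning V x∈V
    in a , ≡.subst (x ≈ᴹ_) (lc-embed a (Basis.vectorsᵇ V)) x≈

  restrict : QMatroid E → QMatroid (asSpace Z)
  restrict M = record
    { ρ          = ρ ∘ embed
    ; bounded    = λ V → ℕ.≤-trans (bounded (embed V)) (dim-embed≤ V)
    ; monotone   = λ V≤W → monotone λ (x∈Z , x∈V) → x∈Z , V≤W x∈V
    ; submodular = λ V W → ℕ.≤-trans
        (ℕ.+-mono-≤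
          (monotone λ (_ , v , w , v∈ , w∈ , x≈) →
            proj₁ v , proj₁ w , (proj₂ v , v∈) , (proj₂ w , w∈) , x≈)
          (monotone λ (x∈Z , x∈V , x∈W) → (x∈Z , x∈V) , (x∈Z , x∈W)))
        (submodular (embed V) (embed W))
    }
    where open QMatroid M

-- The rank formula of a direct sum, with the minimum μ = r − v attained at g − x.
module _ {r v : ℕ} {μ : ℤ} (r≡v+μ : + r ≡ + v ℤ.+ μ) where
  open ℤ.≤-Reasoning

  private
    shift : ∀ v g x → v ℤ.+ (g ℤ.- x) ℤ.+ x ≡ g ℤ.+ v
    shift = ℤRing.solve-∀

  minimum≤⇒ : ∀ g x → μ ℤ.≤ + g ℤ.- + x → r + x ≤ g + v
  minimum≤⇒ g x μ≤ = ℤ.drop‿+≤+ (begin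
    + r ℤ.+ + x                         ≡⟨ ≡.cong (ℤ._+ + x) r≡v+μ ⟩
    + v ℤ.+ μ ℤ.+ + x                   ≤⟨ ℤ.+-monoˡ-≤ (+ x) (ℤ.+-monoʳ-≤ (+ v) μ≤) ⟩
    + v ℤ.+ (+ g ℤ.- + x) ℤ.+ + x       ≡⟨ shift (+ v) (+ g) (+ x) ⟩
    + g ℤ.+ + v                         ∎)

  attains⇒ : ∀ g x → + g ℤ.- + x ≡ μ → g + v ≤ r + x
  attains⇒ g x ≡μ = ℤ.drop‿+≤+ (begin
    + g ℤ.+ + v                         ≡⟨ shift (+ v) (+ g) (+ x) ⟨
    + v ℤ.+ (+ g ℤ.- + x) ℤ.+ + x       ≡⟨ ≡.cong (λ i → + v ℤ.+ i ℤ.+ + x) ≡μ ⟩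
    + v ℤ.+ μ ℤ.+ + x                   ≡⟨ ≡.cong (ℤ._+ + x) r≡v+μ ⟨
    + r ℤ.+ + x                         ∎)

difference-≤ : ∀ i j k l → i + l ≤ k + j → + i ℤ.- + j ℤ.≤ + k ℤ.- + l
difference-≤ i j k l i+l≤k+j = begin
  + i ℤ.- + j                                  ≡⟨ shift (+ i) (+ j) (+ l) ⟩
  + (i + l) ℤ.- (+ j ℤ.+ + l)                  ≤⟨ ℤ.+-monoˡ-≤ (ℤ.- (+ j ℤ.+ + l)) (ℤ.+≤+ i+l≤k+j) ⟩
  + (k + j) ℤ.- (+ j ℤ.+ + l)                  ≡⟨ unshift (+ k) (+ j) (+ l) ⟩
  + k ℤ.- + l                                  ∎
  where
  open ℤ.≤-Reasoning
  shift : ∀ i j l → i ℤ.- j ≡ (i ℤ.+ l) ℤ.- (j ℤ.+ l)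
  shift = ℤRing.solve-∀
  unshift : ∀ k j l → (k ℤ.+ j) ℤ.- (j ℤ.+ l) ≡ k ℤ.- l
  unshift = ℤRing.solve-∀

-- Splittings are direct sums.

module _ {F : FiniteField c ℓ₁ ℓ₂} {E : VectorSpace F m ℓ} (M : QMatroid E) {E₁ E₂ : Subspace E}
         (D : IsDirectDecomposition E₁ E₂) where
  open VectorSpace E
  open Subspace
  open QMatroid M
  open IsDirectDecomposition D
  open ℕ.≤-Reasoning

  private
    part₁ part₂ : Subspace E → Subspace E
    part₁ X = embed E₁ π₁[ X ]
    part₂ X = embed E₂ π₂[ X ]

  ≤-parts : ∀ X → X ≤ₛ part₁ X +ₛ part₂ X
  ≤-parts X {x} x∈ = proj₁ (π₁ x) , proj₁ (π₂ x) ,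
    (proj₂ (π₁ x) , x , x∈ , ≈ᴹ-refl) , (proj₂ (π₂ x) , x , x∈ , ≈ᴹ-refl) , π-decompose x

  -- With `≤-parts`, this makes the projections of `X` the least pair admissible in `Splits`, by
  -- uniqueness of components.
  parts-least : ∀ X A₁ A₂ → A₁ ≤ₛ E₁ → A₂ ≤ₛ E₂ → X ≤ₛ A₁ +ₛ A₂ → part₁ X ≤ₛ A₁ × part₂ X ≤ₛ A₂
  parts-least X A₁ A₂ A₁≤ A₂≤ X≤ = part₁≤ , part₂≤
    where
    part₁≤ : part₁ X ≤ₛ A₁
    part₁≤ (_ , x , x∈ , y≈) =
      let (a₁ , a₂ , a₁∈ , a₂∈ , x≈) = X≤ x∈
      in mem-resp A₁ (≈ᴹ-sym (≈ᴹ-trans y≈ (proj₁ (π-unique (A₁≤ a₁∈) (A₂≤ a₂∈) x≈)))) a₁∈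
    part₂≤ : part₂ X ≤ₛ A₂
    part₂≤ (_ , x , x∈ , y≈) =
      let (a₁ , a₂ , a₁∈ , a₂∈ , x≈) = X≤ x∈
      in mem-resp A₂ (≈ᴹ-sym (≈ᴹ-trans y≈ (proj₂ (π-unique (A₁≤ a₁∈) (A₂≤ a₂∈) x≈)))) a₂∈

  splits⇒directSum : Splits M E₁ E₂ → IsDirectSum M D (restrict E₁ M) (restrict E₂ M)
  splits⇒directSum splits V =
    let (X , X≤V , A₁ , A₂ , A₁≤ , A₂≤ , X≤ , rank) = splits V
        (part₁≤ , part₂≤) = parts-least X A₁ A₂ A₁≤ A₂≤ X≤
    in + ρ V ℤ.- + dim V ,
       ((X , X≤V , ℤ.≤-antisym
          (difference-≤ (ρ (part₁ X) + ρ (part₂ X)) (dim X) (ρ V) (dim V) (ℕ.≤-trans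
            (ℕ.+-monoˡ-≤ (dim V)
              (ℕ.+-mono-≤ (monotone {W = A₁} part₁≤) (monotone {W = A₂} part₂≤))) rank))
          (minimal X X≤V)) ,
        minimal) ,
       ≡.sym (cancel (+ dim V) (+ ρ V))
    where
    cancel : ∀ v r → v ℤ.+ (r ℤ.- v) ≡ r
    cancel = ℤRing.solve-∀
    minimal : ∀ Y → Y ≤ₛ V → + ρ V ℤ.- + dim V ℤ.≤ + (ρ (part₁ Y) + ρ (part₂ Y)) ℤ.- + dim Y
    minimal Y Y≤V = difference-≤ (ρ V) (dim V) (ρ (part₁ Y) + ρ (part₂ Y)) (dim Y) (begin
      ρ V + dim Y                              ≤⟨ nullity-mono M Y V Y≤V ⟩
      ρ Y + dim V                              ≤⟨ ℕ.+-monoˡ-≤ (dim V) (monotone (≤-parts Y)) ⟩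
      ρ (part₁ Y +ₛ part₂ Y) + dim V           ≤⟨ ℕ.+-monoˡ-≤ (dim V) (ρ-+≤ M (part₁ Y) (part₂ Y)) ⟩
      ρ (part₁ Y) + ρ (part₂ Y) + dim V        ∎)

  module _ (M₁ : QMatroid (asSpace E₁)) (M₂ : QMatroid (asSpace E₂)) (M≡M₁⊕M₂ : IsDirectSum M D M₁ M₂) where
    private
      module M₁ = QMatroid M₁
      module M₂ = QMatroid M₂

    -- The candidate `A` itself in the minimum, where the two dimensions cancel.
    rank≤ : ∀ A → ρ A ≤ M₁.ρ π₁[ A ] + M₂.ρ π₂[ A ]
    rank≤ A =
      let (μ , (_ , minimal) , ρA≡) = M≡M₁⊕M₂ A
      in ℕ.+-cancelʳ-≤ (dim A) _ _ (minimum≤⇒ ρA≡ _ (dim A) (minimal A (λ x∈ → x∈)))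

    -- `M₁` and `M₂` are given q-matroids, not restrictions of `M`. On `part₁ X` the second
    -- projection vanishes, so the formula bounds `ρ` by `M₁` alone; this allows `ρ` to replace
    -- their ranks in `Splits`.
    part₁-rank≤ : ∀ X → ρ (part₁ X) ≤ M₁.ρ π₁[ X ]
    part₁-rank≤ X = begin
      ρ (part₁ X)                                        ≤⟨ rank≤ (part₁ X) ⟩
      M₁.ρ π₁[ part₁ X ] + M₂.ρ π₂[ part₁ X ]
        ≤⟨ ℕ.+-mono-≤ (M₁.monotone λ {z} → π₁≤ {z}) (M₂.monotone {W = ⊥ₛ} λ {z} → π₂≤ {z}) ⟩
      M₁.ρ π₁[ X ] + M₂.ρ ⊥ₛ                             ≡⟨ ≡.cong (λ r → M₁.ρ π₁[ X ] + r) (ρ-⊥ M₂) ⟩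
      M₁.ρ π₁[ X ] + 0                                   ≡⟨ ℕ.+-identityʳ _ ⟩
      M₁.ρ π₁[ X ]                                       ∎
      where
      components : ∀ {y} → y ∈ₛ E₁ → proj₁ (π₁ y) ≈ᴹ y × proj₁ (π₂ y) ≈ᴹ 0ᴹ
      components y∈ = π-unique y∈ (0ᴹ-closed E₂) (≈ᴹ-sym (+ᴹ-identityʳ _))
      π₁≤ : π₁[ part₁ X ] ≤ₛ π₁[ X ]
      π₁≤ (y , (y∈E₁ , x , x∈ , y≈) , z≈) =
        x , x∈ , ≈ᴹ-trans z≈ (≈ᴹ-trans (proj₁ (components y∈E₁)) y≈)
      π₂≤ : π₂[ part₁ X ] ≤ₛ ⊥ₛ
      π₂≤ (y , (y∈E₁ , _) , z≈) = lift (≈ᴹ-trans z≈ (proj₂ (components y∈E₁)))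

    part₂-rank≤ : ∀ X → ρ (part₂ X) ≤ M₂.ρ π₂[ X ]
    part₂-rank≤ X = begin
      ρ (part₂ X)                                        ≤⟨ rank≤ (part₂ X) ⟩
      M₁.ρ π₁[ part₂ X ] + M₂.ρ π₂[ part₂ X ]
        ≤⟨ ℕ.+-mono-≤ (M₁.monotone {W = ⊥ₛ} λ {z} → π₁≤ {z}) (M₂.monotone λ {z} → π₂≤ {z}) ⟩
      M₁.ρ ⊥ₛ + M₂.ρ π₂[ X ]                             ≡⟨ ≡.cong (_+ M₂.ρ π₂[ X ]) (ρ-⊥ M₁) ⟩
      M₂.ρ π₂[ X ]                                       ∎
      where
      components : ∀ {y} → y ∈ₛ E₂ → proj₁ (π₁ y) ≈ᴹ 0ᴹ × proj₁ (π₂ y) ≈ᴹ y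
      components y∈ = π-unique (0ᴹ-closed E₁) y∈ (≈ᴹ-sym (+ᴹ-identityˡ _))
      π₁≤ : π₁[ part₂ X ] ≤ₛ ⊥ₛ
      π₁≤ (y , (y∈E₂ , _) , z≈) = lift (≈ᴹ-trans z≈ (proj₁ (components y∈E₂)))
      π₂≤ : π₂[ part₂ X ] ≤ₛ π₂[ X ]
      π₂≤ (y , (y∈E₂ , x , x∈ , y≈) , z≈) =
        x , x∈ , ≈ᴹ-trans z≈ (≈ᴹ-trans (proj₂ (components y∈E₂)) y≈)

    directSum⇒splits : Splits M E₁ E₂
    directSum⇒splits V =
      let (μ , ((X , X≤V , attained) , _) , ρV≡) = M≡M₁⊕M₂ V
      in X , X≤V , part₁ X , part₂ X , proj₁ , proj₁ , ≤-parts X ,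
         ℕ.≤-trans (ℕ.+-monoˡ-≤ (dim V) (ℕ.+-mono-≤ (part₁-rank≤ X) (part₂-rank≤ X)))
           (attains⇒ ρV≡ _ (dim X) attained)

-- Sums of lists of subspaces; a hyperplane and a line as summands.

module _ {F : FiniteField c ℓ₁ ℓ₂} {E : VectorSpace F m ℓ} where
  open VectorSpace E
  open Subspace

  -- Typed names: the ambient space of ⊥ₛ and ⊤ₛ cannot be inferred from membership.
  private
    𝟎 𝟙 : Subspace E
    𝟎 = ⊥ₛ
    𝟙 = ⊤ₛ

  sumₛ-least : ∀ (U : Subspace E) {Vs} → All (_≤ₛ U) Vs → sumₛ Vs ≤ₛ U
  sumₛ-least U []                     = ⊥ₛ-least U
  sumₛ-least U {V ∷ Vs} (V≤U ∷ Vs≤U) = +-least V (sumₛ Vs) U V≤U (sumₛ-least U Vs≤U)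

  ≤-sumₛ : ∀ {V : Subspace E} {Vs} → V ∈ Vs → V ≤ₛ sumₛ Vs
  ≤-sumₛ {V} {_ ∷ Vs} (here ≡.refl)    = ≤-+ˡ V (sumₛ Vs)
  ≤-sumₛ {V} {W ∷ Vs} (there V∈Vs) x∈ = ≤-+ʳ W (sumₛ Vs) (≤-sumₛ V∈Vs x∈)

  hyperplane-decomposition : ∀ (H : Subspace E) {x} → ¬ x ∈ₛ H → 𝟙 ≤ₛ H +ₛ ⟨ x ⟩ →
    IsDirectDecomposition H ⟨ x ⟩
  hyperplane-decomposition H {x} x∉H ⊤≤ = record
    { sum≈⊤          = _ , ⊤≤
    -- A nonzero `y` in the intersection spans `⟨ x ⟩`, by exchange over the zero space, and would
    -- put `x` into `H`.
    ; intersection≈⊥ = (λ {y} (y∈H , y∈⟨x⟩) → decidable-stable (mem? 𝟎 y) λ y∉⊥ →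
        x∉H (+⟨⟩-least 𝟎 H (⊥ₛ-least H) y∈H (exchange 𝟎 (≤-+ʳ 𝟎 ⟨ x ⟩ y∈⟨x⟩) y∉⊥))) ,
        ⊥ₛ-least (H ∩ₛ ⟨ x ⟩)
    }

  -- The point where `2 ≤ dimension` enters: the complement of a line must be a legitimate nonzero
  -- summand.
  hyperplane≉⊥ : 2 ≤ dimension → ∀ (H : Subspace E) x → 𝟙 ≤ₛ H +ₛ ⟨ x ⟩ → ¬ (H ≈ₛ 𝟎)
  hyperplane≉⊥ 2≤ H x ⊤≤ (H≤⊥ , _) = ℕ.<⇒≱ 2≤ (begin
    dimension                  ≤⟨ ≤dim 𝟙 {b = basis} (IsBasis.independent isBasis) _ ⟩
    dim 𝟙             ≤⟨ dim-mono 𝟙 (𝟎 +ₛ ⟨ x ⟩) (λ {y} _ → +-mono H 𝟎 ⟨ x ⟩ ⟨ x ⟩ H≤⊥ (λ z∈ → z∈) (⊤≤ {y} _)) ⟩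
    dim (𝟎 +ₛ ⟨ x ⟩)          ≤⟨ dim-+⟨⟩≤ 𝟎 x ⟩
    suc (dim 𝟎)       ≡⟨ ≡.cong suc (dim-⊥ {E = E}) ⟩
    1                          ∎)
    where open ℕ.≤-Reasoning

  ⟨⟩≉⊥ : ∀ {x} → ¬ x ∈ₛ 𝟎 → ¬ (⟨ x ⟩ ≈ₛ 𝟎)
  ⟨⟩≉⊥ {x} x∉⊥ (⟨x⟩≤⊥ , _) = x∉⊥ (⟨x⟩≤⊥ (∈⟨⟩ {E = E} x))

-- Loops, coloops and fullness.

module _ {F : FiniteField c ℓ₁ ℓ₂} {E : VectorSpace F m ℓ} (M : QMatroid E) where
  open VectorSpace E
  open Subspace
  open QMatroid M
  open CommutativeSemigroupProperties ℕ.+-commutativeSemigroup using (x∙yz≈xz∙y; x∙yz≈yx∙z)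
  open ℕ.≤-Reasoning

  private
    𝟎 𝟙 : Subspace E
    𝟎 = ⊥ₛ
    𝟙 = ⊤ₛ

  splits⇒reducible : ∀ {E₁ E₂} → ¬ (E₁ ≈ₛ 𝟎) → ¬ (E₂ ≈ₛ 𝟎) →
    IsDirectDecomposition E₁ E₂ → Splits M E₁ E₂ → IsReducible M
  splits⇒reducible {E₁} {E₂} E₁≉⊥ E₂≉⊥ D splits =
    E₁ , E₂ , E₁≉⊥ , E₂≉⊥ , D , restrict E₁ M , restrict E₂ M , splits⇒directSum M D splits

  -- Any hyperplane `H` avoiding the loop serves. `A` is the shadow of `V` on `H` along `x`, and
  -- adding a vector of rank zero to `V` does not change its rank.
  loop⇒reducible : 2 ≤ dimension → ∀ {x} → ¬ x ∈ₛ 𝟎 → ρ ⟨ x ⟩ ≡ 0 → IsReducible M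
  loop⇒reducible 2≤ {x} x∉⊥ ρ≡0 =
    let (H , _ , _ , x∉H , ⊤≤) = hyperplane-above 𝟎 𝟙 _ _ x∉⊥
    in splits⇒reducible (hyperplane≉⊥ 2≤ H x ⊤≤) (⟨⟩≉⊥ {E = E} x∉⊥) (hyperplane-decomposition H x∉H ⊤≤)
         (splits H ⊤≤)
    where
    splits : ∀ H → 𝟙 ≤ₛ H +ₛ ⟨ x ⟩ → Splits M H ⟨ x ⟩
    splits H ⊤≤ V = V , (λ y∈ → y∈) , A , ⟨ x ⟩ , proj₁ , (λ y∈ → y∈) , V≤ ,
      ℕ.+-monoˡ-≤ (dim V) (begin
        ρ A + ρ ⟨ x ⟩               ≡⟨ ≡.cong (λ r → ρ A + r) ρ≡0 ⟩
        ρ A + 0                     ≡⟨ ℕ.+-identityʳ (ρ A) ⟩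
        ρ A                         ≤⟨ monotone proj₂ ⟩
        ρ (V +ₛ ⟨ x ⟩)              ≤⟨ ρ-+≤ M V ⟨ x ⟩ ⟩
        ρ V + ρ ⟨ x ⟩               ≡⟨ ≡.cong (λ r → ρ V + r) ρ≡0 ⟩
        ρ V + 0                     ≡⟨ ℕ.+-identityʳ (ρ V) ⟩
        ρ V                         ∎)
      where
      A : Subspace E
      A = H ∩ₛ (V +ₛ ⟨ x ⟩)
      V≤ : V ≤ₛ A +ₛ ⟨ x ⟩
      V≤ {v} v∈ =
        let (h , w , h∈ , w∈ , v≈) = ⊤≤ {v} _
        in h , w ,
           (h∈ , mem-resp (V +ₛ ⟨ x ⟩) (≈ᴹ-sym (move-right {E = E} v≈))
             (difference-closed (V +ₛ ⟨ x ⟩) (≤-+ˡ V ⟨ x ⟩ v∈) (≤-+ʳ V ⟨ x ⟩ w∈))) ,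
           w∈ , v≈

  -- The witness is `H ∩ₛ V` with nothing on the side of `x`. If `V` is not inside `H`, then
  -- `H +ₛ V` is everything, and submodularity makes `V` lose rank along with its one dimension when
  -- cut by `H`.
  coloop⇒reducible : 2 ≤ dimension → ∀ H {x} → 𝟙 ≤ₛ H +ₛ ⟨ x ⟩ → ρ H < ρ 𝟙 → IsReducible M
  coloop⇒reducible 2≤ H {x} ⊤≤ ρH<ρ⊤ = splits⇒reducible (hyperplane≉⊥ 2≤ H x ⊤≤)
    (⟨⟩≉⊥ {E = E} (x∉H ∘ ⊥ₛ-least H)) (hyperplane-decomposition H x∉H ⊤≤) splits
    where
    x∉H : ¬ x ∈ₛ H
    x∉H x∈H = ℕ.<⇒≱ ρH<ρ⊤ (monotone λ {y} _ → +⟨⟩-least H H (λ z∈ → z∈) x∈H (⊤≤ {y} _))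
    rank : ∀ V → ρ (H ∩ₛ V) + dim V ≤ ρ V + dim (H ∩ₛ V)
    rank V with ≤-or-outside V H
    ... | inj₁ V≤H = ℕ.+-mono-≤ (monotone proj₂) (dim-mono V (H ∩ₛ V) λ v∈ → V≤H v∈ , v∈)
    ... | inj₂ (v , v∈V , v∉H) = begin
      ρ (H ∩ₛ V) + dim V                    ≤⟨ ℕ.+-monoʳ-≤ _ (ℕ.≤-trans
                                                 (dim-mono V (H ∩ₛ V +ₛ ⟨ v ⟩)
                                                   (hyperplane-slice 𝟙 H V ⊤≤ _ v∈V v∉H))
                                                 (dim-+⟨⟩≤ (H ∩ₛ V) v)) ⟩
      ρ (H ∩ₛ V) + suc (dim (H ∩ₛ V))       ≡⟨ ℕ.+-suc (ρ (H ∩ₛ V)) _ ⟩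
      suc (ρ (H ∩ₛ V)) + dim (H ∩ₛ V)       ≤⟨ ℕ.+-monoˡ-≤ _ rank-drop ⟩
      ρ V + dim (H ∩ₛ V)                    ∎
      where
      ⊤≤H+V : 𝟙 ≤ₛ H +ₛ V
      ⊤≤H+V {y} _ = +⟨⟩-least H (H +ₛ V) (≤-+ˡ H V)
        (+⟨⟩-least H (H +ₛ V) (≤-+ˡ H V) (≤-+ʳ H V v∈V) (exchange H (⊤≤ {v} _) v∉H)) (⊤≤ {y} _)
      rank-drop : suc (ρ (H ∩ₛ V)) ≤ ρ V
      rank-drop = ℕ.+-cancelˡ-≤ (ρ H) _ _ (begin
        ρ H + suc (ρ (H ∩ₛ V))              ≡⟨ ℕ.+-suc (ρ H) _ ⟩
        suc (ρ H) + ρ (H ∩ₛ V)              ≤⟨ ℕ.+-monoˡ-≤ _ (ℕ.≤-trans ρH<ρ⊤ (monotone ⊤≤H+V)) ⟩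
        ρ (H +ₛ V) + ρ (H ∩ₛ V)             ≤⟨ submodular H V ⟩
        ρ H + ρ V                           ∎)
    splits : Splits M H ⟨ x ⟩
    splits V = H ∩ₛ V , proj₂ , H ∩ₛ V , 𝟎 , proj₁ , ⊥ₛ-least {E = E} ⟨ x ⟩ , ≤-+ˡ (H ∩ₛ V) 𝟎 , (begin
      ρ (H ∩ₛ V) + ρ 𝟎 + dim V             ≡⟨ ≡.cong (λ r → ρ (H ∩ₛ V) + r + dim V) (ρ-⊥ M) ⟩
      ρ (H ∩ₛ V) + 0 + dim V                ≡⟨ ≡.cong (λ r → r + dim V) (ℕ.+-identityʳ _) ⟩
      ρ (H ∩ₛ V) + dim V                    ≤⟨ rank V ⟩
      ρ V + dim (H ∩ₛ V)                    ∎)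

  irreducible⇒full : 2 ≤ dimension → IsIrreducible M → IsFull
  irreducible⇒full 2≤ irreducible = (cl⊥≤⊥ , ⊥ₛ-least (cl 𝟎)) , _ , λ _ → _ , λ W _ (_ , ⊤≤) →
    ℕ.≤-antisym (monotone _) (ℕ.≮⇒≥ λ ρW<ρ⊤ → irreducible (coloop⇒reducible 2≤ W ⊤≤ ρW<ρ⊤))
    where
    cl⊥≤⊥ : cl 𝟎 ≤ₛ 𝟎
    cl⊥≤⊥ = sumₛ-least 𝟎 (All.map⁺ (All.map
      (λ {x} ρ≡ {_} → ⟨⟩-least 𝟎 (decidable-stable (mem? 𝟎 x) λ x∉⊥ → irreducible
        (loop⇒reducible 2≤ x∉⊥ (ℕ.n≤0⇒n≡0 (begin
          ρ ⟨ x ⟩                ≤⟨ monotone (≤-+ʳ 𝟎 ⟨ x ⟩) ⟩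
          ρ (𝟎 +ₛ ⟨ x ⟩)        ≡⟨ ρ≡ ⟩
          ρ 𝟎                   ≡⟨ ρ-⊥ M ⟩
          0                      ∎)))))
      (All.all-filter (λ x → ρ (𝟎 +ₛ ⟨ x ⟩) ℕ.≟ ρ 𝟎) (elements E))))

  loopless : cl 𝟎 ≤ₛ 𝟎 → ∀ {x} → ¬ x ∈ₛ 𝟎 → 1 ≤ ρ ⟨ x ⟩
  loopless cl⊥≤⊥ {x} x∉⊥ = ℕ.≰⇒> λ ρ≤0 →
    -- `cl` sums over the list `elements`, which contains `x` only up to `≈ᴹ`, so the listed copy
    -- `y` is the one shown to be a loop.
    let (y , y∈elements , x≈y) = find (elements-complete E x)
        ρ≡ : ρ (𝟎 +ₛ ⟨ y ⟩) ≡ ρ 𝟎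
        ρ≡ = ℕ.≤-antisym
          (begin
            ρ (𝟎 +ₛ ⟨ y ⟩)
              ≤⟨ monotone (+⟨⟩-least 𝟎 ⟨ x ⟩ (⊥ₛ-least {E = E} ⟨ x ⟩)
                   (mem-resp {E = E} ⟨ x ⟩ x≈y (∈⟨⟩ {E = E} x))) ⟩
            ρ ⟨ x ⟩              ≤⟨ ρ≤0 ⟩
            0                    ≤⟨ z≤n ⟩
            ρ 𝟎                 ∎)
          (monotone (≤-+ˡ 𝟎 ⟨ y ⟩))
    in x∉⊥ (mem-resp 𝟎 (≈ᴹ-sym x≈y) (cl⊥≤⊥
         (≤-sumₛ (∈-map⁺ ⟨_⟩ (∈-filter⁺ (λ z → ρ (𝟎 +ₛ ⟨ z ⟩) ℕ.≟ ρ 𝟎) y∈elements ρ≡)) (∈⟨⟩ {E = E} y))))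

  -- Decompositions into cyclic flats.

  IsCyclicFlatDecomposition : Subspace E → Subspace E → Set _
  IsCyclicFlatDecomposition Z₁ Z₂ =
    𝒵 Z₁ × 𝒵 Z₂ × IsDirectDecomposition Z₁ Z₂ × ρ Z₁ + ρ Z₂ ≡ ρ 𝟙 ×
    (∀ Z →
      (∃₂ λ (Y₁ Y₂ : Subspace E) → (𝒵 Y₁ × Y₁ ≤ₛ Z₁) × (𝒵 Y₂ × Y₂ ≤ₛ Z₂) × (Z ≈ₛ Y₁ +ₛ Y₂))
      ⇔ 𝒵 Z)

  cyclicFlats⇒splits : ∀ Z₁ Z₂ → IsCyclicFlatDecomposition Z₁ Z₂ → Splits M Z₁ Z₂
  cyclicFlats⇒splits Z₁ Z₂ (_ , _ , D , ρ⊤≡ , products) V =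
    let (Z , Z∈𝒵 , rank) = rank-via-cyclic-flat M V
        (Y₁ , Y₂ , (_ , Y₁≤) , (_ , Y₂≤) , (Z≤ , ≤Z)) = Equivalence.from (products Z) Z∈𝒵
    in V ∩ₛ Z , proj₁ , Y₁ , Y₂ , Y₁≤ , Y₂≤ , (λ (_ , x∈Z) → Z≤ x∈Z) ,
       ℕ.≤-trans (ℕ.+-monoˡ-≤ (dim V) (ℕ.≤-trans (additive Y₁ Y₂ Y₁≤ Y₂≤) (monotone ≤Z))) rank
    where
    -- Additivity descends from `Z₁`, `Z₂` to subspaces by diminishing returns, first shrinking `Z₂`
    -- to `Y₂` and then `Z₁` to `Y₁`.
    additive : ∀ Y₁ Y₂ → Y₁ ≤ₛ Z₁ → Y₂ ≤ₛ Z₂ → ρ Y₁ + ρ Y₂ ≤ ρ (Y₁ +ₛ Y₂)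
    additive Y₁ Y₂ Y₁≤ Y₂≤ = ℕ.+-cancelˡ-≤ (ρ Z₁) _ _ (begin
      ρ Z₁ + (ρ Y₁ + ρ Y₂)                    ≡⟨ x∙yz≈xz∙y (ρ Z₁) (ρ Y₁) (ρ Y₂) ⟩
      ρ Z₁ + ρ Y₂ + ρ Y₁                      ≤⟨ ℕ.+-monoˡ-≤ (ρ Y₁) additive₂ ⟩
      ρ (Z₁ +ₛ Y₂) + ρ Y₁                     ≤⟨ submodular-translate M Y₁ Z₁ Y₂ Y₁≤ ⟩
      ρ Z₁ + ρ (Y₁ +ₛ Y₂)                     ∎)
      where
      additive₂ : ρ Z₁ + ρ Y₂ ≤ ρ (Z₁ +ₛ Y₂)
      additive₂ = ℕ.+-cancelˡ-≤ (ρ Z₂) _ _ (begin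
        ρ Z₂ + (ρ Z₁ + ρ Y₂)                  ≡⟨ x∙yz≈yx∙z (ρ Z₂) (ρ Z₁) (ρ Y₂) ⟩
        ρ Z₁ + ρ Z₂ + ρ Y₂                    ≡⟨ ≡.cong (λ r → r + ρ Y₂) ρ⊤≡ ⟩
        ρ 𝟙 + ρ Y₂                           ≤⟨ ℕ.+-monoˡ-≤ (ρ Y₂) (monotone λ {x} _ →
                                                   +-swap Z₁ Z₂ (proj₂ (IsDirectDecomposition.sum≈⊤ D) {x} _)) ⟩
        ρ (Z₂ +ₛ Z₁) + ρ Y₂                   ≤⟨ submodular-translate M Y₂ Z₂ Z₁ Y₂≤ ⟩
        ρ Z₂ + ρ (Y₂ +ₛ Z₁)                   ≤⟨ ℕ.+-monoʳ-≤ (ρ Z₂) (monotone (+-swap Y₂ Z₁)) ⟩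
        ρ Z₂ + ρ (Z₁ +ₛ Y₂)                   ∎)

  -- Both halves of fullness act: a vector outside `Z₁` has a nonzero component in `Z₂`, which is no
  -- loop and so adds rank; and `Z₁` inherits cyclicity as a component of the cyclic space `⊤ₛ`.
  summand-∈𝒵 : IsFull → ∀ Z₁ Z₂ → IsDirectDecomposition Z₁ Z₂ → Splits M Z₁ Z₂ → 𝒵 Z₁
  summand-∈𝒵 ((cl⊥≤⊥ , _) , cyclic⊤) Z₁ Z₂ D splits = (λ {x} → flat {x}) ,
    component-cyclic M 𝟙 Z₁ Z₂ cyclic⊤ _ (λ {x} _ → proj₂ (IsDirectDecomposition.sum≈⊤ D) {x} _)
      (ℕ.≤-trans (ρ-additive M D splits Z₁ Z₂ (λ y∈ → y∈) (λ y∈ → y∈)) (monotone _))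
    where
    flat : IsFlat Z₁
    flat {x} x∉ =
      let (v , w , v∈ , w∈ , x≈) = proj₂ (IsDirectDecomposition.sum≈⊤ D) {x} _
          w∉⊥ : ¬ w ∈ₛ 𝟎
          w∉⊥ (lift w≈0) = x∉ (mem-resp Z₁
            (≈ᴹ-sym (≈ᴹ-trans x≈ (≈ᴹ-trans (+ᴹ-congˡ w≈0) (+ᴹ-identityʳ v)))) v∈)
          w∈Z₁+⟨x⟩ = mem-resp (Z₁ +ₛ ⟨ x ⟩) (≈ᴹ-sym (move-left {E = E} x≈))
            (difference-closed (Z₁ +ₛ ⟨ x ⟩) (∈-+⟨⟩ Z₁ x) (≤-+ˡ Z₁ ⟨ x ⟩ v∈))
      in begin
        suc (ρ Z₁)                ≡⟨ ℕ.+-comm 1 (ρ Z₁) ⟩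
        ρ Z₁ + 1                  ≤⟨ ℕ.+-monoʳ-≤ (ρ Z₁) (loopless cl⊥≤⊥ w∉⊥) ⟩
        ρ Z₁ + ρ ⟨ w ⟩            ≤⟨ ρ-additive M D splits Z₁ ⟨ w ⟩ (λ y∈ → y∈) (⟨⟩-least Z₂ w∈) ⟩
        ρ (Z₁ +ₛ ⟨ w ⟩)           ≤⟨ monotone (+⟨⟩-least Z₁ (Z₁ +ₛ ⟨ x ⟩) (≤-+ˡ Z₁ ⟨ x ⟩) w∈Z₁+⟨x⟩) ⟩
        ρ (Z₁ +ₛ ⟨ x ⟩)           ∎

  -- Once `X` is all of `Z`, the sum `A₁ +ₛ A₂` contains `Z` without exceeding its rank, so flatness
  -- of `Z` gives equality.
  cyclicFlat-components : ∀ {Z₁ Z₂} → Splits M Z₁ Z₂ → ∀ Z → 𝒵 Z → ∃₂ λ A₁ A₂ →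
    A₁ ≤ₛ Z₁ × A₂ ≤ₛ Z₂ × Z ≤ₛ A₁ +ₛ A₂ × A₁ +ₛ A₂ ≤ₛ Z × ρ A₁ + ρ A₂ ≤ ρ Z
  cyclicFlat-components splits Z (flat , cyclic) =
    let (X , X≤Z , A₁ , A₂ , A₁≤ , A₂≤ , X≤A , rank) = splits Z
        Z≤X = exhausted X A₁ A₂ X≤Z X≤A rank
        ρA≤ρZ = ℕ.+-cancelʳ-≤ (dim Z) (ρ A₁ + ρ A₂) (ρ Z)
          (ℕ.≤-trans rank (ℕ.+-monoʳ-≤ (ρ Z) (dim-mono X Z X≤Z)))
        Z≤A : Z ≤ₛ A₁ +ₛ A₂
        Z≤A = λ z∈ → X≤A (Z≤X z∈)
    in A₁ , A₂ , A₁≤ , A₂≤ , Z≤A ,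
       flat-maximal M Z (A₁ +ₛ A₂) flat Z≤A (ℕ.≤-trans (ρ-+≤ M A₁ A₂) ρA≤ρZ) , ρA≤ρZ
    where
    exhausted : ∀ X A₁ A₂ → X ≤ₛ Z → X ≤ₛ A₁ +ₛ A₂ → ρ A₁ + ρ A₂ + dim Z ≤ ρ Z + dim X → Z ≤ₛ X
    exhausted X A₁ A₂ X≤Z X≤A rank with ≤-or-outside Z X
    ... | inj₁ Z≤X = Z≤X
    ... | inj₂ (x , x∈Z , x∉X) =
      let (W , X≤W , W≤Z , x∉W , Z≤) = hyperplane-above X Z X≤Z x∈Z x∉X
      in contradiction rank (ℕ.<⇒≱ (begin-strict
        ρ Z + dim X                   ≤⟨ ℕ.+-monoˡ-≤ (dim X) (cyclic-rank M Z W cyclic x∈Z W≤Z Z≤) ⟩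
        ρ W + dim X                   ≤⟨ nullity-mono M X W X≤W ⟩
        ρ X + dim W                   <⟨ ℕ.+-monoʳ-< (ρ X) (ℕ.≤-trans (dim-+⟨⟩> W x∉W)
                                           (dim-mono (W +ₛ ⟨ x ⟩) Z (+⟨⟩-least W Z W≤Z x∈Z))) ⟩
        ρ X + dim Z                   ≤⟨ ℕ.+-monoˡ-≤ (dim Z) (ℕ.≤-trans (monotone X≤A) (ρ-+≤ M A₁ A₂)) ⟩
        ρ A₁ + ρ A₂ + dim Z           ∎))

  splits⇒cyclicFlats : IsFull → ∀ Z₁ Z₂ → IsDirectDecomposition Z₁ Z₂ → Splits M Z₁ Z₂ →
    IsCyclicFlatDecomposition Z₁ Z₂
  splits⇒cyclicFlats full Z₁ Z₂ D splits =
    Z₁∈𝒵 , Z₂∈𝒵 , D ,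
    ℕ.≤-antisym
      (ℕ.≤-trans (ρ-additive M D splits Z₁ Z₂ (λ y∈ → y∈) (λ y∈ → y∈)) (monotone _))
      (ℕ.≤-trans (monotone λ {x} _ → proj₂ (IsDirectDecomposition.sum≈⊤ D) {x} _) (ρ-+≤ M Z₁ Z₂)) ,
    λ Z → mk⇔
      (λ (Y₁ , Y₂ , ((flat₁ , cyclic₁) , Y₁≤) , ((flat₂ , cyclic₂) , Y₂≤) , (Z≤ , ≤Z)) →
        -- `Z` only has the same vectors as `Y₁ +ₛ Y₂`; `flat-below` and `cyclic-same-rank` carry
        -- flatness and cyclicity across this equality.
        (λ {x} x∉ → flat-below M Z (Y₁ +ₛ Y₂) (+-flat M D splits Y₁ Y₂ Y₁≤ Y₂≤ flat₁ flat₂) Z≤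
          (λ x∈ → x∉ (≤Z x∈))) ,
        cyclic-same-rank M (Y₁ +ₛ Y₂) Z ≤Z (monotone Z≤) (+-cyclic M Y₁ Y₂ cyclic₁ cyclic₂))
      (λ Z∈𝒵@(flat , cyclic) →
        let (A₁ , A₂ , A₁≤ , A₂≤ , Z≤A , A≤Z , rank) = cyclicFlat-components {Z₁} {Z₂} splits Z Z∈𝒵
            A′≤Z : A₂ +ₛ A₁ ≤ₛ Z
            A′≤Z = λ y∈ → A≤Z (+-swap A₂ A₁ y∈)
            Z≤A′ : Z ≤ₛ A₂ +ₛ A₁
            Z≤A′ = λ y∈ → +-swap A₁ A₂ (Z≤A y∈)
            rank′ = ≡.subst (λ r → r ≤ ρ Z) (ℕ.+-comm (ρ A₁) (ρ A₂)) rank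
        in A₁ , A₂ ,
           (((λ {x} → component-flat M D splits Z A₁ A₂ (proj₁ Z₁∈𝒵) flat A₁≤ A₂≤ A≤Z Z≤A {x}) ,
             component-cyclic M Z A₁ A₂ cyclic A≤Z Z≤A rank) , A₁≤) ,
           (((λ {x} → component-flat M D′ splits′ Z A₂ A₁ (proj₁ Z₂∈𝒵) flat A₂≤ A₁≤ A′≤Z Z≤A′ {x}) ,
             component-cyclic M Z A₂ A₁ cyclic A′≤Z Z≤A′ rank′) , A₂≤) ,
           (Z≤A , A≤Z))
    where
    D′ : IsDirectDecomposition Z₂ Z₁
    D′ = decomposition-swap D
    splits′ : Splits M Z₂ Z₁
    splits′ = splits-swap M {Z₁} {Z₂} splits
    Z₁∈𝒵 : 𝒵 Z₁
    Z₁∈𝒵 = summand-∈𝒵 full Z₁ Z₂ D splits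
    Z₂∈𝒵 : 𝒵 Z₂
    Z₂∈𝒵 = summand-∈𝒵 full Z₂ Z₁ D′ splits′

  -- The property negated in (ii).
  Decomposable : Set _
  Decomposable = ∃₂ λ Z₁ Z₂ → ¬ (Z₁ ≈ₛ 𝟎) × ¬ (Z₂ ≈ₛ 𝟎) × IsCyclicFlatDecomposition Z₁ Z₂

  decomposable⇒reducible : Decomposable → IsReducible M
  decomposable⇒reducible (Z₁ , Z₂ , Z₁≉⊥ , Z₂≉⊥ , decomposition) =
    splits⇒reducible {Z₁} {Z₂} Z₁≉⊥ Z₂≉⊥ (proj₁ (proj₂ (proj₂ decomposition)))
      (cyclicFlats⇒splits Z₁ Z₂ decomposition)

  reducible⇒decomposable : IsFull → IsReducible M → Decomposable
  reducible⇒decomposable full (E₁ , E₂ , E₁≉⊥ , E₂≉⊥ , D , M₁ , M₂ , M≡M₁⊕M₂) =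
    E₁ , E₂ , E₁≉⊥ , E₂≉⊥ ,
    splits⇒cyclicFlats full E₁ E₂ D (directSum⇒splits M D M₁ M₂ M≡M₁⊕M₂)

  irreducible⇔full×indecomposable : 2 ≤ dimension → IsIrreducible M ⇔ (IsFull × ¬ Decomposable)
  irreducible⇔full×indecomposable 2≤ = mk⇔
    (λ irreducible → irreducible⇒full 2≤ irreducible , irreducible ∘ decomposable⇒reducible)
    (λ (full , indecomposable) → indecomposable ∘ reducible⇒decomposable full)

theorem7p13 :
  ∀ {c ℓ₁ ℓ₂ m ℓ : Level} (F : FiniteField c ℓ₁ ℓ₂) (E : VectorSpace F m ℓ) (M : QMatroid E) →
  let open QMatroid M in
  2 ≤ VectorSpace.dimension E →
  IsIrreducible M ⇔
    (IsFull ×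
     ¬ (∃₂ λ (Z₁ Z₂ : Subspace E) →
          ¬ (Z₁ ≈ₛ ⊥ₛ) × ¬ (Z₂ ≈ₛ ⊥ₛ) × 𝒵 Z₁ × 𝒵 Z₂ ×
          IsDirectDecomposition Z₁ Z₂ ×
          ρ Z₁ + ρ Z₂ ≡ ρ ⊤ₛ ×
          (∀ Z →
            (∃₂ λ (Y₁ Y₂ : Subspace E) →
               (𝒵 Y₁ × Y₁ ≤ₛ Z₁) × (𝒵 Y₂ × Y₂ ≤ₛ Z₂) × (Z ≈ₛ Y₁ +ₛ Y₂))
            ⇔ 𝒵 Z)))
theorem7p13 F E M 2≤ = irreducible⇔full×indecomposable M 2≤
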